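{- Let $a \geq 2$ and $k$ be integers. If $(k,a)\neq(0,2)$, then there are infinitely many positive integers $n$ such that $a^{n-k}\equiv 1 \pmod{n}$. If $(k,a)=(0,2)$, then there is no integer $n>1$ such that $a^{n-k}\equiv 1 \pmod n$ (i.e. $2^n \equiv 1 \pmod n$). -}

module Defs where

open import Data.Nat using (ℕ; _^_)
open import Data.Integer using (ℤ; +_; _-_; ∣_∣; _≤_)
open import Data.Integer.Divisibility using (_∣_)

-- ExpCong a n e : "a^e ≡ 1 (mod n)" for an integer exponent e.
-- For e ≥ 0 this is n ∣ a^e − 1 in ℤ.  For e < 0, a^e ≡ 1 (mod n) means
-- a is a unit mod n and (a⁻¹)^|e| ≡ 1, which is equivalent to a^|e| ≡ 1 (mod n);
-- so in both cases we state n ∣ a^|e| − 1.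
ExpCong : ℕ → ℕ → ℤ → Set
ExpCong a n e = (+ n) ∣ ((+ (a ^ ∣ e ∣)) - + 1)

{-# OPTIONS --safe #-}

-- Let n be a solution with e = n − k and let M > 1 divide a ^ e − 1 with every
-- divisor of M congruent to 1 modulo e. If M is coprime to n, then n M is a
-- solution too: e divides n M − k = e + n (M − 1), and n M divides a ^ e − 1.
-- Coprimality is automatic when e ≥ k and k ≠ 1, because a common divisor
-- other than 1 exceeds e; for k = 1, M itself is a solution.
--
-- Such an M is the part of Φ_e(a) prime to e. The number Φ_e(a) is the quotient
-- of a ^ e − 1 by the least common multiple of the a ^ (e / p) − 1 over the primes p
-- dividing e; it has at most one prime factor in common with e, and that one only
-- to the first power. The recursion Φ_{mp}(x) Φ_m(x) = Φ_m(x ^ p), p ∤ m, bounds it from below.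
--
-- The construction starts at n = M for the exponent k − 1 if k is large, at n = 1
-- if k is very negative, at n = a − 1 if a is large compared with k, and from a
-- table in the remaining finitely many cases.
--
-- For (k , a) = (0 , 2), if p is a prime factor of n then 2 has order dividing
-- gcd(n, p − 1) modulo p, so n has a prime factor smaller than p.
module Submission where

open import Defs
open import Data.Empty using (⊥; ⊥-elim)
open import Data.List using (List; []; _∷_; map; filter; downFrom)
open import Data.List.Membership.Propositional using (_∈_)
open import Data.List.Membership.Propositional.Properties using (∈-filter⁺; ∈-downFrom⁺)
open import Data.List.Relation.Unary.All as All using (All; []; _∷_)
import Data.List.Relation.Unary.All.Properties as All
open import Data.List.Relation.Unary.AllPairs using (AllPairs; []; _∷_)
import Data.List.Relation.Unary.AllPairs.Properties as AllPairs
open import Data.List.Relation.Unary.Any as Any using (Any; any?; here; there)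
open import Data.Nat
open import Data.Nat.Combinatorics using (_C_; nCn≡1; nC1≡n; nCk+nC[k+1]≡[n+1]C[k+1])
open import Data.Nat.Combinatorics.Specification using (k>n⇒nCk≡0)
open import Data.Nat.Coprimality using (Coprime; coprime⇒gcd≡1; prime⇒coprime; coprime-divisor)
open import Data.Nat.DivMod using (m%n<n; m≡m%n+[m/n]*n; m/n*n≡m)
open import Data.Nat.Divisibility
open import Data.Nat.GCD
open import Data.Nat.Induction using (<-rec)
open import Data.Nat.LCM
open import Data.Nat.ListAction using (product)
open import Data.Nat.ListAction.Properties using (∈⇒∣product)
open import Data.Nat.Primality
open import Data.Nat.Primality.Factorisation
  using (factorise; PrimeFactorisation; factorisationHasAllPrimeFactors)
open import Data.Nat.Properties
open import Data.Nat.Tactic.RingSolver using (solve-∀)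
open import Data.Product using (_×_; _,_; ∃-syntax; proj₁; proj₂)
open import Data.Sum using (_⊎_; inj₁; inj₂)
open import Function using (case_of_)
open import Relation.Binary.PropositionalEquality
  using (_≡_; _≢_; refl; sym; trans; cong; cong₂; subst; module ≡-Reasoning)
open import Relation.Nullary using (¬_; Dec; yes; no; contradiction; ¬?; _×-dec_; _→-dec_)
open import Relation.Nullary.Decidable using (from-yes; from-no)

-- Prime divisors, and divisibility among the numbers `a ^ e ∸ 1`.

prime>1 : ∀ {p} → Prime p → 1 < p
prime>1 {p} pp = nonTrivial⇒n>1 p {{prime⇒nonTrivial pp}}

∃-primeDivisor : ∀ n → 1 < n → ∃[ p ] (Prime p × p ∣ n)
∃-primeDivisor n 1<n = go (factorise n) where
  instance
    n≢0 : NonZero n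
    n≢0 = >-nonZero (<-trans z<s 1<n)
  open PrimeFactorisation
  go : PrimeFactorisation n → ∃[ p ] (Prime p × p ∣ n)
  go record { factors = [] ; isFactorisation = eq } = contradiction eq (>⇒≢ 1<n)
  go record { factors = p ∷ ps ; isFactorisation = eq ; factorsPrime = pp ∷ _ } =
    p , pp , subst (p ∣_) (sym eq) (m∣m*n (product ps))

prime-∣prime⇒≡ : ∀ {p q} → Prime p → Prime q → p ∣ q → p ≡ q
prime-∣prime⇒≡ pp pq p∣q with prime⇒irreducible pq p∣q
... | inj₁ p≡1 = contradiction p≡1 (>⇒≢ (prime>1 pp))
... | inj₂ p≡q = p≡q

-- a ^ e ∸ 1 only truncates when a ^ e = 0, which NonZero a excludes.
module _ (a : ℕ) .{{a≢0 : NonZero a}} where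

  suc[^∸1] : ∀ e → suc (a ^ e ∸ 1) ≡ a ^ e
  suc[^∸1] e = suc-pred (a ^ e) {{m^n≢0 a e}}

  ^∸1-+ : ∀ i j → a ^ (i + j) ∸ 1 ≡ a ^ i * (a ^ j ∸ 1) + (a ^ i ∸ 1)
  ^∸1-+ i j = suc-injective (begin
    suc (a ^ (i + j) ∸ 1)                    ≡⟨ suc[^∸1] (i + j) ⟩
    a ^ (i + j)                              ≡⟨ ^-distribˡ-+-* a i j ⟩
    a ^ i * a ^ j                            ≡⟨ cong (a ^ i *_) (suc[^∸1] j) ⟨
    a ^ i * suc (a ^ j ∸ 1)                  ≡⟨ *-suc (a ^ i) _ ⟩
    a ^ i + a ^ i * (a ^ j ∸ 1)              ≡⟨ +-comm (a ^ i) _ ⟩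
    a ^ i * (a ^ j ∸ 1) + a ^ i              ≡⟨ cong (a ^ i * (a ^ j ∸ 1) +_) (suc[^∸1] i) ⟨
    a ^ i * (a ^ j ∸ 1) + suc (a ^ i ∸ 1)    ≡⟨ +-suc _ _ ⟩
    suc (a ^ i * (a ^ j ∸ 1) + (a ^ i ∸ 1))  ∎)
    where open ≡-Reasoning

  ^∸1-mono-∣ : ∀ {i j} → i ∣ j → a ^ i ∸ 1 ∣ a ^ j ∸ 1
  ^∸1-mono-∣ {i} (divides q refl) = go q where
    go : ∀ q → a ^ i ∸ 1 ∣ a ^ (q * i) ∸ 1
    go zero    = _ ∣0
    go (suc q) = subst (a ^ i ∸ 1 ∣_) (sym (^∸1-+ i (q * i)))
      (∣m∣n⇒∣m+n (∣n⇒∣m*n (a ^ i) (go q)) ∣-refl)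

  ∣^∸1-difference : ∀ {n} i j → n ∣ a ^ (i + j) ∸ 1 → n ∣ a ^ j ∸ 1 → n ∣ a ^ i ∸ 1
  ∣^∸1-difference {n} i j n∣i+j n∣j =
    ∣m+n∣m⇒∣n (subst (n ∣_) (^∸1-+ i j) n∣i+j) (∣n⇒∣m*n (a ^ i) n∣j)

  -- Bézout gives `gcd i j` as a multiple of one exponent minus a multiple of the other, and a
  -- difference of exponents needs no inverse of `a`: a ^ (i + j) - 1 = a ^ i (a ^ j - 1) + (a ^ i -
  -- 1).
  ∣^∸1-gcd : ∀ {n} i j → n ∣ a ^ i ∸ 1 → n ∣ a ^ j ∸ 1 → n ∣ a ^ gcd i j ∸ 1
  ∣^∸1-gcd {n} i j n∣i n∣j with Bézout.identity (gcd-GCD i j)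
  ... | Bézout.+- x y eq = ∣^∸1-difference (gcd i j) (y * j)
    (subst (λ e → n ∣ a ^ e ∸ 1) (sym eq) (∣-trans n∣i (^∸1-mono-∣ (n∣m*n x))))
    (∣-trans n∣j (^∸1-mono-∣ (n∣m*n y)))
  ... | Bézout.-+ x y eq = ∣^∸1-difference (gcd i j) (x * i)
    (subst (λ e → n ∣ a ^ e ∸ 1) (sym eq) (∣-trans n∣j (^∸1-mono-∣ (n∣m*n y))))
    (∣-trans n∣i (^∸1-mono-∣ (n∣m*n x)))

-- Geometric sums.

geometric : ℕ → ℕ → ℕ
geometric A zero    = 0
geometric A (suc p) = 1 + A * geometric A p

geometric-*-∸1 : ∀ A .{{_ : NonZero A}} p → geometric A p * (A ∸ 1) ≡ A ^ p ∸ 1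
geometric-*-∸1 A@(suc B) zero    = refl
geometric-*-∸1 A@(suc B) (suc p) = begin
  (1 + A * g) * B            ≡⟨ rearrange B g ⟩
  A * (g * B) + B            ≡⟨ cong (λ z → A * z + B) (geometric-*-∸1 A p) ⟩
  A * (A ^ p ∸ 1) + B        ≡⟨ cong (λ z → z * (A ^ p ∸ 1) + (z ∸ 1)) (*-identityʳ A) ⟨
  A ^ 1 * (A ^ p ∸ 1) + (A ^ 1 ∸ 1)        ≡⟨ ^∸1-+ A 1 p ⟨
  A ^ suc p ∸ 1              ∎
  where
  open ≡-Reasoning
  g = geometric A p
  rearrange : ∀ B g → (1 + suc B * g) * B ≡ suc B * (g * B) + B
  rearrange = solve-∀

triangle : ℕ → ℕ
triangle zero    = 0
triangle (suc p) = triangle p + p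

2*triangle : ∀ p → 2 * triangle (suc p) ≡ suc p * p
2*triangle zero    = refl
2*triangle (suc p) = begin
  2 * (triangle (suc p) + suc p)      ≡⟨ *-distribˡ-+ 2 (triangle (suc p)) (suc p) ⟩
  2 * triangle (suc p) + 2 * suc p    ≡⟨ cong (_+ 2 * suc p) (2*triangle p) ⟩
  suc p * p + 2 * suc p               ≡⟨ rearrange p ⟩
  suc (suc p) * suc p                 ∎
  where
  open ≡-Reasoning
  rearrange : ∀ p → suc p * p + 2 * suc p ≡ suc (suc p) * suc p
  rearrange = solve-∀

-- Taylor expansion of 1 + A + ... + A ^ (p - 1) at A = 1 + B. The coefficient `triangle p` = p (p -
-- 1) / 2 is divisible by p for odd p, so when p divides B only the term p survives modulo p ^ 2.
geometric-expansion : ∀ B p →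
  ∃[ c ] (geometric (suc B) p ≡ p + (B * triangle p + B * B * c))
geometric-expansion B zero    = 0 , sym (cong₂ _+_ (*-zeroʳ B) (*-zeroʳ (B * B)))
geometric-expansion B (suc p) with geometric-expansion B p
... | c , eq = c + triangle p + B * c ,
  trans (cong (λ g → 1 + suc B * g) eq) (rearrange B p (triangle p) c)
  where
  rearrange : ∀ B p t c → 1 + suc B * (p + (B * t + B * B * c))
                        ≡ suc p + (B * (t + p) + B * B * (c + t + B * c))
  rearrange = solve-∀

-- The binomial theorem and Fermat's little theorem.

binomialSum : ℕ → ℕ → ℕ → ℕ
binomialSum a n zero    = 0
binomialSum a n (suc m) = binomialSum a n m + (n C m) * a ^ m

binomialSum-suc : ∀ a n m →
  suc a * binomialSum a n m + (n C m) * a ^ m ≡ binomialSum a (suc n) (suc m)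
binomialSum-suc a n zero    = cong (_+ (n C 0) * 1) (*-zeroʳ a)
binomialSum-suc a n (suc m) = begin
  suc a * (S + c * x) + c′ * (a * x)           ≡⟨ rearrange a S c x c′ ⟩
  (suc a * S + c * x) + (c + c′) * (a * x)     ≡⟨ cong₂ (λ u v → u + v * (a * x))
                                                    (binomialSum-suc a n m)
                                                    (nCk+nC[k+1]≡[n+1]C[k+1] n m) ⟩
  binomialSum a (suc n) (suc m) + (suc n C suc m) * a ^ suc m ∎
  where
  open ≡-Reasoning
  S = binomialSum a n m
  c = n C m
  c′ = n C suc m
  x = a ^ m
  rearrange : ∀ a S c x c′ → suc a * (S + c * x) + c′ * (a * x)
                           ≡ (suc a * S + c * x) + (c + c′) * (a * x)
  rearrange = solve-∀

binomialSum≡^ : ∀ a n → binomialSum a n (suc n) ≡ suc a ^ n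
binomialSum≡^ a zero    = refl
binomialSum≡^ a (suc n) = begin
  binomialSum a (suc n) (suc (suc n))
    ≡⟨ binomialSum-suc a n (suc n) ⟨
  suc a * binomialSum a n (suc n) + (n C suc n) * a ^ suc n
    ≡⟨ cong₂ (λ u v → suc a * u + v * a ^ suc n) (binomialSum≡^ a n) (k>n⇒nCk≡0 (n<1+n n)) ⟩
  suc a * suc a ^ n + 0
    ≡⟨ +-identityʳ _ ⟩
  suc a ^ suc n ∎
  where open ≡-Reasoning

[1+k]*[1+n]C[1+k] : ∀ n k → suc k * (suc n C suc k) ≡ suc n * (n C k)
[1+k]*[1+n]C[1+k] zero zero        = refl
[1+k]*[1+n]C[1+k] zero (suc k)     = begin
  suc (suc k) * (1 C suc (suc k))  ≡⟨ cong (suc (suc k) *_) (k>n⇒nCk≡0 {1} {suc (suc k)} (s<s z<s)) ⟩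
  suc (suc k) * 0                  ≡⟨ *-zeroʳ (suc (suc k)) ⟩
  0                                ≡⟨ cong (1 *_) (k>n⇒nCk≡0 {0} {suc k} z<s) ⟨
  1 * (0 C suc k)                  ∎
  where open ≡-Reasoning
[1+k]*[1+n]C[1+k] (suc n) zero     = trans (+-identityʳ _)
  (trans (nC1≡n (suc (suc n))) (sym (*-identityʳ _)))
[1+k]*[1+n]C[1+k] (suc n) (suc k)  = begin
  suc (suc k) * (suc (suc n) C suc (suc k))
    ≡⟨ cong (suc (suc k) *_) (nCk+nC[k+1]≡[n+1]C[k+1] (suc n) (suc k)) ⟨
  suc (suc k) * (u + v)
    ≡⟨ rearrange k u v ⟩
  u + (suc k * u + suc (suc k) * v)
    ≡⟨ cong (u +_) (cong₂ _+_ ([1+k]*[1+n]C[1+k] n k) ([1+k]*[1+n]C[1+k] n (suc k))) ⟩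
  u + (suc n * (n C k) + suc n * (n C suc k))
    ≡⟨ cong (u +_) (*-distribˡ-+ (suc n) (n C k) (n C suc k)) ⟨
  u + suc n * (n C k + n C suc k)
    ≡⟨ cong (λ z → u + suc n * z) (nCk+nC[k+1]≡[n+1]C[k+1] n k) ⟩
  suc (suc n) * u ∎
  where
  open ≡-Reasoning
  u = suc n C suc k
  v = suc n C suc (suc k)
  rearrange : ∀ k u v → suc (suc k) * (u + v) ≡ u + (suc k * u + suc (suc k) * v)
  rearrange = solve-∀

prime∣C : ∀ {p k} → Prime p → 0 < k → k < p → p ∣ p C k
prime∣C {suc n} {suc k} pp _ k<p
  with euclidsLemma (suc k) _ pp (subst (suc n ∣_) (sym ([1+k]*[1+n]C[1+k] n k)) (m∣m*n (n C k)))
... | inj₁ p∣k = contradiction p∣k (>⇒∤ k<p)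
... | inj₂ p∣C = p∣C

prime-binomialSum : ∀ {p} a m → Prime p → m < p → ∃[ c ] (binomialSum a p (suc m) ≡ 1 + p * c)
prime-binomialSum {p} a zero    pp _   = 0 , cong suc (sym (*-zeroʳ p))
prime-binomialSum {p} a (suc m) pp m<p
  with prime-binomialSum a m pp (<-trans (n<1+n m) m<p) | prime∣C pp (z<s {m}) m<p
... | c , eq | divides q eq′ = c + q * a ^ suc m ,
  trans (cong₂ (λ u v → u + v * a ^ suc m) eq eq′) (rearrange p c q (a ^ suc m))
  where
  rearrange : ∀ p c q x → 1 + p * c + q * p * x ≡ 1 + p * (c + q * x)
  rearrange = solve-∀

fermat-^p : ∀ {p} → Prime p → ∀ a → ∃[ c ] (a ^ p ≡ a + p * c)
fermat-^p {suc n} pp zero    = 0 , sym (*-zeroʳ (suc n))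
fermat-^p {suc n} pp (suc a) with fermat-^p pp a | prime-binomialSum a n pp (n<1+n n)
... | c , eq | c′ , eq′ = c′ + c , (begin
  suc a ^ p                                      ≡⟨ binomialSum≡^ a p ⟨
  binomialSum a p p + (p C p) * a ^ p            ≡⟨ cong₂ (λ u v → u + v * a ^ p) eq′ (nCn≡1 p) ⟩
  1 + p * c′ + 1 * a ^ p                         ≡⟨ cong (1 + p * c′ +_) (trans (*-identityˡ (a ^ p)) eq) ⟩
  1 + p * c′ + (a + p * c)                       ≡⟨ rearrange p a c c′ ⟩
  suc a + p * (c′ + c)                           ∎)
  where
  open ≡-Reasoning
  p = suc n
  rearrange : ∀ p a c c′ → 1 + p * c′ + (a + p * c) ≡ suc a + p * (c′ + c)
  rearrange = solve-∀

fermat : ∀ {p} → Prime p → ∀ a → ¬ p ∣ a → p ∣ a ^ (p ∸ 1) ∸ 1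
fermat {suc n} pp zero    p∤a = contradiction (suc n ∣0) p∤a
fermat {suc n} pp a@(suc _) p∤a with fermat-^p pp a
... | c , eq with euclidsLemma a (a ^ n ∸ 1) pp (divides c (+-cancelˡ-≡ a _ _ (begin
      a + a * (a ^ n ∸ 1)  ≡⟨ *-suc a _ ⟨
      a * suc (a ^ n ∸ 1)  ≡⟨ cong (a *_) (suc[^∸1] a n) ⟩
      a * a ^ n            ≡⟨ eq ⟩
      a + suc n * c        ≡⟨ cong (a +_) (*-comm (suc n) c) ⟩
      a + c * suc n        ∎)))
  where open ≡-Reasoning
... | inj₁ p∣a = contradiction p∣a p∤a
... | inj₂ h   = h

-- Values of cyclotomic polynomials of squarefree index.

^-distribʳ-* : ∀ o m n → (m * n) ^ o ≡ m ^ o * n ^ o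
^-distribʳ-* zero    m n = refl
^-distribʳ-* (suc o) m n =
  trans (cong (m * n *_) (^-distribʳ-* o m n)) (*-interchange m n (m ^ o) (n ^ o))
  where
  *-interchange : ∀ a b c d → (a * b) * (c * d) ≡ (a * c) * (b * d)
  *-interchange = solve-∀

^-swap : ∀ x m n → (x ^ m) ^ n ≡ (x ^ n) ^ m
^-swap x m n = trans (^-*-assoc x m n) (trans (cong (x ^_) (*-comm m n)) (sym (^-*-assoc x n m)))

gcd-nonZeroʳ : ∀ m n .{{_ : NonZero n}} → NonZero (gcd m n)
gcd-nonZeroʳ m n = ≢-nonZero λ eq → ≢-nonZero⁻¹ n (gcd[m,n]≡0⇒n≡0 m eq)

-- Half of the distributivity of gcd over lcm.
∣lcm⇒∣ : ∀ u v {w} z .{{_ : NonZero z}} → z ∣ lcm u v → gcd u z ∣ w → gcd v z ∣ w → z ∣ w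
∣lcm⇒∣ u v z z∣lcm hu hv = ∣-trans z∣ℓ (lcm-least hu hv)
  where
  gᵤ = gcd u z
  gᵥ = gcd v z
  g = gcd gᵤ gᵥ
  instance
    gᵥ≢0 : NonZero gᵥ
    gᵥ≢0 = gcd-nonZeroʳ v z
    g≢0 : NonZero g
    g≢0 = gcd-nonZeroʳ gᵤ gᵥ
  g∣u : g ∣ u
  g∣u = ∣-trans (gcd[m,n]∣m gᵤ gᵥ) (gcd[m,n]∣m u z)
  g∣v : g ∣ v
  g∣v = ∣-trans (gcd[m,n]∣n gᵤ gᵥ) (gcd[m,n]∣m v z)
  -- Multiplying by `g` turns lcms into products: g z divides v u, then v gcd(u, z), then gcd(u, z)
  -- gcd(v, z), which is `g` times the lcm wanted.
  gz∣uv : g * z ∣ v * u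
  gz∣uv = subst (g * z ∣_) (trans (gcd*lcm u v) (*-comm u v)) (*-pres-∣ (gcd-greatest g∣u g∣v) z∣lcm)
  gz∣vgᵤ : g * z ∣ v * gᵤ
  gz∣vgᵤ = subst (g * z ∣_) (sym (c*gcd[m,n]≡gcd[cm,cn] v u z))
    (gcd-greatest gz∣uv (*-pres-∣ g∣v ∣-refl))
  gz∣gᵤgᵥ : g * z ∣ gᵤ * gᵥ
  gz∣gᵤgᵥ = subst (g * z ∣_) (sym (c*gcd[m,n]≡gcd[cm,cn] gᵤ v z))
    (gcd-greatest (subst (g * z ∣_) (*-comm v gᵤ) gz∣vgᵤ) (*-pres-∣ (gcd[m,n]∣m gᵤ gᵥ) ∣-refl))
  z∣ℓ : z ∣ lcm gᵤ gᵥ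
  z∣ℓ = *-cancelˡ-∣ g (subst (g * z ∣_) (sym (gcd*lcm gᵤ gᵥ)) gz∣gᵤgᵥ)

-- For distinct primes ps with product P this is the least common multiple of
-- the numbers x ^ (P / p) ∸ 1 with p in ps.
properLcm : List ℕ → ℕ → ℕ
properLcm []       x = 1
properLcm (p ∷ ps) x = lcm (properLcm ps (x ^ p)) (x ^ product ps ∸ 1)

properLcm-∣ : ∀ ps x .{{_ : NonZero x}} → properLcm ps x ∣ x ^ product ps ∸ 1
properLcm-∣ []       x = 1∣ _
properLcm-∣ (p ∷ ps) x = lcm-least
  (subst (λ y → properLcm ps (x ^ p) ∣ y ∸ 1) (^-*-assoc x p (product ps))
    (properLcm-∣ ps (x ^ p) {{m^n≢0 x p}}))
  (^∸1-mono-∣ x (n∣m*n p))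

properLcm-^ : ∀ ps x .{{_ : NonZero x}} m → properLcm ps x ∣ properLcm ps (x ^ m)
properLcm-^ []       x m = ∣-refl
properLcm-^ (p ∷ ps) x m = lcm-least
  (∣-trans (subst (λ y → properLcm ps (x ^ p) ∣ properLcm ps y) (^-swap x p m)
             (properLcm-^ ps (x ^ p) {{m^n≢0 x p}} m))
           (m∣lcm[m,n] _ _))
  (∣-trans (subst (λ y → x ^ product ps ∸ 1 ∣ y ∸ 1) (sym (^-*-assoc x m (product ps)))
             (^∸1-mono-∣ x (n∣m*n m)))
           (n∣lcm[m,n] (properLcm ps ((x ^ m) ^ p)) _))

-- `∣lcm⇒∣` allows one component of the lcm to be treated at a time, with `z` replaced by its gcd
-- with it. There the claim is one about exponents: a divisor of x ^ (P m) - 1 and x ^ (P q) - 1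
-- divides x ^ P - 1, since m is prime to q.
∣properLcm-^⇒∣properLcm : ∀ ps x .{{_ : NonZero x}} m z .{{_ : NonZero z}} → All (Coprime m) ps →
  z ∣ properLcm ps (x ^ m) → z ∣ x ^ product ps ∸ 1 → z ∣ properLcm ps x
∣properLcm-^⇒∣properLcm []       x m z _          z∣L _  = z∣L
∣properLcm-^⇒∣properLcm (q ∷ ps) x m z (m⊥q ∷ m⊥ps) z∣L z∣x = ∣lcm⇒∣ U V z z∣L
  (∣-trans
    (∣properLcm-^⇒∣properLcm ps (x ^ q) {{m^n≢0 x q}} m (gcd U z) {{gcd-nonZeroʳ U z}} m⊥ps
      (subst (λ y → gcd U z ∣ properLcm ps y) (^-swap x m q) (gcd[m,n]∣m U z))
      (∣-trans (gcd[m,n]∣n U z) (subst (λ y → z ∣ y ∸ 1) (sym (^-*-assoc x q P)) z∣x)))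
    (m∣lcm[m,n] _ _))
  (∣-trans
    (subst (λ e → gcd V z ∣ x ^ e ∸ 1) gcd≡P (∣^∸1-gcd x (P * m) (P * q)
      (subst (λ e → gcd V z ∣ e ∸ 1) (trans (^-*-assoc x m P) (cong (x ^_) (*-comm m P)))
        (gcd[m,n]∣m V z))
      (∣-trans (gcd[m,n]∣n V z) (subst (λ e → z ∣ x ^ e ∸ 1) (*-comm q P) z∣x))))
    (n∣lcm[m,n] (properLcm ps (x ^ q)) _))
  where
  P = product ps
  U = properLcm ps ((x ^ m) ^ q)
  V = (x ^ m) ^ P ∸ 1
  gcd≡P : gcd (P * m) (P * q) ≡ P
  gcd≡P = trans (sym (c*gcd[m,n]≡gcd[cm,cn] P m q))
    (trans (cong (P *_) (coprime⇒gcd≡1 m⊥q)) (*-identityʳ P))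

-- Decreasing order makes the primes distinct and the head the largest; it puts 2 last, so that a
-- list headed by 2 is `2 ∷ []`.
DescendingPrimes : List ℕ → Set
DescendingPrimes ps = All Prime ps × AllPairs _>_ ps

descending-tail : ∀ {p ps} → DescendingPrimes (p ∷ ps) → DescendingPrimes ps
descending-tail (_ ∷ pps , _ ∷ desc) = pps , desc

descending-coprime : ∀ {p ps} → DescendingPrimes (p ∷ ps) → All (Coprime p) ps
descending-coprime {p} (pp ∷ pps , p>ps ∷ _) =
  All.zipWith {R = Coprime p} (λ (pq , p>q) → prime⇒coprime pp {{prime⇒nonZero pq}} p>q) (pps , p>ps)

^∸1-nonZero : ∀ x e → 1 < x → .{{_ : NonZero e}} → NonZero (x ^ e ∸ 1)
^∸1-nonZero x (suc e) 1<x = >-nonZero (m<n⇒0<n∸m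
  (<-≤-trans 1<x (m≤m*n x (x ^ e) {{m^n≢0 x e {{>-nonZero (<-trans z<s 1<x)}}}})))

module _ {p ps} (desc : DescendingPrimes (p ∷ ps)) (x : ℕ) (1<x : 1 < x) where
  private instance
    x≢0 : NonZero x
    x≢0 = >-nonZero (<-trans z<s 1<x)
    P≢0 : NonZero (product ps)
    P≢0 = productOfPrimes≢0 (proj₁ (descending-tail desc))

  -- These are the two numbers whose lcm is `properLcm (p ∷ ps) x`; knowing their gcd turns gcd ·
  -- lcm = product into a recursion for `properLcm`.
  gcd-properLcm : gcd (properLcm ps (x ^ p)) (x ^ product ps ∸ 1) ≡ properLcm ps x
  gcd-properLcm = ∣-antisym
    (∣properLcm-^⇒∣properLcm ps x p _ {{gcd-nonZeroʳ (properLcm ps (x ^ p)) _ {{^∸1-nonZero x _ 1<x}}}}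
      (descending-coprime desc)
      (gcd[m,n]∣m (properLcm ps (x ^ p)) _) (gcd[m,n]∣n (properLcm ps (x ^ p)) _))
    (gcd-greatest (properLcm-^ ps x p) (properLcm-∣ ps x))

  properLcm-∷ : properLcm ps x * properLcm (p ∷ ps) x ≡ properLcm ps (x ^ p) * (x ^ product ps ∸ 1)
  properLcm-∷ = trans (cong (_* properLcm (p ∷ ps) x) (sym gcd-properLcm))
    (gcd*lcm (properLcm ps (x ^ p)) _)

-- For distinct primes ps, the value at x of the cyclotomic polynomial of index product ps.
cyclotomic : ∀ ps x .{{_ : NonZero x}} → ℕ
cyclotomic ps x = quotient (properLcm-∣ ps x)

cyclotomic-*-properLcm : ∀ ps x .{{_ : NonZero x}} →
  cyclotomic ps x * properLcm ps x ≡ x ^ product ps ∸ 1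
cyclotomic-*-properLcm ps x = sym (_∣_.equality (properLcm-∣ ps x))

cyclotomic-[] : ∀ x .{{_ : NonZero x}} → cyclotomic [] x ≡ x ∸ 1
cyclotomic-[] x = trans (sym (*-identityʳ _))
  (trans (cyclotomic-*-properLcm [] x) (cong (_∸ 1) (*-identityʳ x)))

-- Multiplied by the two lcms, either side equals (x ^ (p P) - 1) (x ^ P - 1) with P = `product ps`;
-- on the right this is `properLcm-∷`.
cyclotomic-∷ : ∀ {p ps} → DescendingPrimes (p ∷ ps) → ∀ x .{{_ : NonZero x}} → 1 < x →
  cyclotomic (p ∷ ps) x * cyclotomic ps x ≡ cyclotomic ps (x ^ p) {{m^n≢0 x p}}
cyclotomic-∷ {p} {ps} desc@(pp ∷ pps , _) x 1<x =
  *-cancelʳ-≡ _ _ (l′ * l) {{m*n≢0 l′ l {{nonZeroˡ (p ∷ ps) (pp ∷ pps)}} {{nonZeroˡ ps pps}}}} (begin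
  (Q′ * Q) * (l′ * l)                        ≡⟨ interchange Q′ Q l′ l ⟩
  (Q′ * l′) * (Q * l)                        ≡⟨ cong₂ _*_ (cyclotomic-*-properLcm (p ∷ ps) x)
                                                          (cyclotomic-*-properLcm ps x) ⟩
  (x ^ (p * P) ∸ 1) * (x ^ P ∸ 1)            ≡⟨ cong (λ y → (y ∸ 1) * (x ^ P ∸ 1)) (^-*-assoc x p P) ⟨
  ((x ^ p) ^ P ∸ 1) * (x ^ P ∸ 1)            ≡⟨ cong (_* (x ^ P ∸ 1)) (cyclotomic-*-properLcm ps (x ^ p)) ⟨
  cyclotomic ps (x ^ p) * properLcm ps (x ^ p) * (x ^ P ∸ 1)
                                             ≡⟨ *-assoc (cyclotomic ps (x ^ p)) _ _ ⟩
  cyclotomic ps (x ^ p) * (properLcm ps (x ^ p) * (x ^ P ∸ 1))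
                                             ≡⟨ cong (cyclotomic ps (x ^ p) *_) (properLcm-∷ desc x 1<x) ⟨
  cyclotomic ps (x ^ p) * (l * l′)           ≡⟨ cong (cyclotomic ps (x ^ p) *_) (*-comm l l′) ⟩
  cyclotomic ps (x ^ p) * (l′ * l)           ∎)
  where
  open ≡-Reasoning
  instance
    x^p≢0 : NonZero (x ^ p)
    x^p≢0 = m^n≢0 x p
  P = product ps
  Q′ = cyclotomic (p ∷ ps) x
  Q = cyclotomic ps x
  l′ = properLcm (p ∷ ps) x
  l = properLcm ps x
  interchange : ∀ a b c d → (a * b) * (c * d) ≡ (a * c) * (b * d)
  interchange = solve-∀
  nonZeroˡ : ∀ qs → All Prime qs → NonZero (properLcm qs x)
  nonZeroˡ qs pqs = ≢-nonZero λ eq → ≢-nonZero⁻¹ _ {{^∸1-nonZero x (product qs) 1<x {{productOfPrimes≢0 pqs}}}}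
    (0∣⇒≡0 (subst (_∣ x ^ product qs ∸ 1) eq (properLcm-∣ qs x)))

∈⇒^∸1∣properLcm : ∀ {q ps} m x .{{_ : NonZero x}} → All Prime ps → q ∈ ps → m * q ≡ product ps →
  x ^ m ∸ 1 ∣ properLcm ps x
∈⇒^∸1∣properLcm {q} {p ∷ ps} m x (pp ∷ _) (here refl) eq
  rewrite *-cancelʳ-≡ m (product ps) p {{prime⇒nonZero pp}} (trans eq (*-comm p _)) =
  n∣lcm[m,n] (properLcm ps (x ^ p)) _
∈⇒^∸1∣properLcm {q} {p ∷ ps} m x (pp ∷ pps) (there q∈ps) eq with ∈⇒∣product q∈ps
... | divides m′ eq′ = ∣-trans
  (subst (λ y → y ∸ 1 ∣ properLcm ps (x ^ p)) (trans (^-*-assoc x p m′) (cong (x ^_) (sym m≡pm′)))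
    (∈⇒^∸1∣properLcm m′ (x ^ p) {{m^n≢0 x p}} pps q∈ps (sym eq′)))
  (m∣lcm[m,n] _ _)
  where
  m≡pm′ : m ≡ p * m′
  m≡pm′ = *-cancelʳ-≡ m (p * m′) q {{prime⇒nonZero (All.lookup pps q∈ps)}}
    (trans eq (trans (cong (p *_) eq′) (sym (*-assoc p m′ q))))

-- Bounds for cyclotomic values.

totient : List ℕ → ℕ
totient ps = product (map pred ps)

x^[p-2]*[x²-1]≤x^p-1 : ∀ w r → let x = suc w in (x ^ suc r * w) * suc x ≤ x ^ (3 + r) ∸ 1
x^[p-2]*[x²-1]≤x^p-1 w r = ∸-monoˡ-≤ {suc _} 1 (begin-strict
  (y * w) * suc x         <⟨ m<m+n _ (m^n>0 x (suc r)) ⟩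
  (y * w) * suc x + y     ≡⟨ rearrange w y ⟩
  x * (x * y)             ∎)
  where
  open ≤-Reasoning
  x = suc w
  y = x ^ suc r
  rearrange : ∀ w y → (y * w) * suc (suc w) + y ≡ suc w * (suc w * y)
  rearrange = solve-∀

x^p+1≤[x-1]*[x+1]^[p-1] : ∀ v r → let x = 2 + v in suc (x ^ (3 + r)) ≤ suc v * suc x ^ (2 + r)
x^p+1≤[x-1]*[x+1]^[p-1] v zero = begin
  suc (x ^ 3)                        ≤⟨ m≤m+n _ (v * v + 3 * v) ⟩
  suc (x ^ 3) + (v * v + 3 * v)      ≡⟨ rearrange v ⟩
  suc v * suc x ^ 2                  ∎
  where
  open ≤-Reasoning
  x = 2 + v
  rearrange : ∀ v → suc ((2 + v) * ((2 + v) * ((2 + v) * 1))) + (v * v + 3 * v)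
                  ≡ suc v * ((3 + v) * ((3 + v) * 1))
  rearrange = solve-∀
x^p+1≤[x-1]*[x+1]^[p-1] v (suc r) = begin
  suc (x * z)                        ≤⟨ s≤s (m≤m+n (x * z) (x + z)) ⟩
  suc (x * z + (x + z))              ≡⟨ rearrange x z ⟩
  suc x * suc z                      ≤⟨ *-monoʳ-≤ (suc x) (x^p+1≤[x-1]*[x+1]^[p-1] v r) ⟩
  suc x * (suc v * suc x ^ (2 + r))  ≡⟨ *-comm-assoc (suc x) (suc v) (suc x ^ (2 + r)) ⟩
  suc v * suc x ^ (3 + r)            ∎
  where
  open ≤-Reasoning
  x = 2 + v
  z = x ^ (3 + r)
  rearrange : ∀ x z → suc (x * z + (x + z)) ≡ suc x * suc z
  rearrange = solve-∀
  *-comm-assoc : ∀ a b c → a * (b * c) ≡ b * (a * c)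
  *-comm-assoc = solve-∀

1<x⇒1<x^p : ∀ {x p} → 1 < x → Prime p → 1 < x ^ p
1<x⇒1<x^p {x} {suc p} 1<x pp = <-≤-trans 1<x
  (m≤m*n x (x ^ p) {{m^n≢0 x p {{>-nonZero (<-trans z<s 1<x)}}}})

descending-[2] : ∀ {ps} → DescendingPrimes (2 ∷ ps) → ps ≡ []
descending-[2] {[]}    _ = refl
descending-[2] {q ∷ _} (_ ∷ pq ∷ _ , (2>q ∷ _) ∷ _) = contradiction 2>q (≤⇒≯ (prime>1 pq))

cyclotomic-[2] : ∀ x .{{_ : NonZero x}} → 1 < x → cyclotomic (2 ∷ []) x ≡ suc x
cyclotomic-[2] x@(suc (suc v)) 1<x@(s≤s (s≤s _)) = *-cancelʳ-≡ _ _ (suc v) (begin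
  cyclotomic (2 ∷ []) x * suc v            ≡⟨ cong (cyclotomic (2 ∷ []) x *_) (cyclotomic-[] x) ⟨
  cyclotomic (2 ∷ []) x * cyclotomic [] x  ≡⟨ cyclotomic-∷ (prime[2] ∷ [] , [] ∷ []) x 1<x ⟩
  cyclotomic [] (x ^ 2)                    ≡⟨ cyclotomic-[] (x ^ 2) ⟩
  x ^ 2 ∸ 1                                ≡⟨ rearrange v ⟩
  suc x * suc v                            ∎)
  where
  open ≡-Reasoning
  rearrange : ∀ v → (1 + v) * 1 + (1 + v) * ((2 + v) * 1) ≡ (3 + v) * suc v
  rearrange = solve-∀

mutual
  -- The recursion gives the value for `p ∷ ps` as a quotient of two values for `ps`, so the lower
  -- bound (x - 1) ^ φ and the upper bound (x + 1) ^ φ need each other. For p = 2 the value is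
  -- exactly x + 1.
  cyclotomic-lower : ∀ ps x .{{_ : NonZero x}} → 1 < x → DescendingPrimes ps →
    (x ∸ 1) ^ totient ps ≤ cyclotomic ps x
  cyclotomic-lower [] x 1<x _ = ≤-reflexive (trans (*-identityʳ _) (sym (cyclotomic-[] x)))
  cyclotomic-lower (0 ∷ ps) x 1<x (pp ∷ _ , _) = contradiction pp ¬prime[0]
  cyclotomic-lower (1 ∷ ps) x 1<x (pp ∷ _ , _) = contradiction pp ¬prime[1]
  cyclotomic-lower (2 ∷ ps) x@(suc w) 1<x desc rewrite descending-[2] desc =
    ≤-trans (≤-reflexive (*-identityʳ w))
      (≤-trans (≤-trans (n≤1+n w) (n≤1+n x)) (≤-reflexive (sym (cyclotomic-[2] x 1<x))))
  cyclotomic-lower (p@(suc (suc (suc r))) ∷ ps) x@(suc w) 1<x desc = begin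
    w ^ (suc (suc r) * f)          ≡⟨ ^-*-assoc w (suc (suc r)) f ⟨
    (w ^ suc (suc r)) ^ f          ≡⟨ cong (_^ f) (*-comm w (w ^ suc r)) ⟩
    (w ^ suc r * w) ^ f            ≤⟨ ^-monoˡ-≤ f (*-monoˡ-≤ w (^-monoˡ-≤ (suc r) (n≤1+n w))) ⟩
    (x ^ suc r * w) ^ f            ≤⟨ cyclotomic-∷-lower r ps x 1<x desc ⟩
    cyclotomic (p ∷ ps) x          ∎
    where
    open ≤-Reasoning
    f = totient ps

  -- Keeping the factor x ^ (p - 2) for the largest prime p matters at x = 2, where
  -- `cyclotomic-lower` gives only 1.
  cyclotomic-∷-lower : ∀ r ps x .{{_ : NonZero x}} → 1 < x → DescendingPrimes (3 + r ∷ ps) →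
    (x ^ suc r * (x ∸ 1)) ^ totient ps ≤ cyclotomic (3 + r ∷ ps) x
  cyclotomic-∷-lower r ps x@(suc w) 1<x desc@(pp ∷ _ , _) =
    *-cancelʳ-≤ _ _ (suc x ^ f) {{m^n≢0 (suc x) f}} (begin
    (x ^ suc r * w) ^ f * suc x ^ f               ≡⟨ ^-distribʳ-* f (x ^ suc r * w) (suc x) ⟨
    ((x ^ suc r * w) * suc x) ^ f                 ≤⟨ ^-monoˡ-≤ f (x^[p-2]*[x²-1]≤x^p-1 w r) ⟩
    (x ^ p ∸ 1) ^ f                               ≤⟨ cyclotomic-lower ps (x ^ p) {{m^n≢0 x p}}
                                                       (1<x⇒1<x^p 1<x pp) (descending-tail desc) ⟩
    cyclotomic ps (x ^ p) {{m^n≢0 x p}}           ≡⟨ cyclotomic-∷ desc x 1<x ⟨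
    cyclotomic (p ∷ ps) x * cyclotomic ps x       ≤⟨ *-monoʳ-≤ (cyclotomic (p ∷ ps) x)
                                                       (cyclotomic-upper ps x 1<x (descending-tail desc)) ⟩
    cyclotomic (p ∷ ps) x * suc x ^ f             ∎)
    where
    open ≤-Reasoning
    p = 3 + r
    f = totient ps

  cyclotomic-upper : ∀ ps x .{{_ : NonZero x}} → 1 < x → DescendingPrimes ps →
    cyclotomic ps x ≤ suc x ^ totient ps
  cyclotomic-upper [] x 1<x _ = begin
    cyclotomic [] x  ≡⟨ cyclotomic-[] x ⟩
    x ∸ 1            ≤⟨ m∸n≤m x 1 ⟩
    x                ≤⟨ n≤1+n x ⟩
    suc x            ≡⟨ *-identityʳ (suc x) ⟨
    suc x ^ 1        ∎
    where open ≤-Reasoning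
  cyclotomic-upper (0 ∷ ps) x 1<x (pp ∷ _ , _) = contradiction pp ¬prime[0]
  cyclotomic-upper (1 ∷ ps) x 1<x (pp ∷ _ , _) = contradiction pp ¬prime[1]
  cyclotomic-upper (2 ∷ ps) x 1<x desc rewrite descending-[2] desc =
    ≤-reflexive (trans (cyclotomic-[2] x 1<x) (sym (*-identityʳ (suc x))))
  cyclotomic-upper (p@(suc (suc (suc r))) ∷ ps) x@(suc w@(suc v)) 1<x@(s≤s (s≤s _)) desc@(pp ∷ _ , _) =
    *-cancelʳ-≤ _ _ (w ^ f) {{m^n≢0 w f}} (begin
    cyclotomic (p ∷ ps) x * w ^ f                 ≤⟨ *-monoʳ-≤ (cyclotomic (p ∷ ps) x)
                                                       (cyclotomic-lower ps x 1<x (descending-tail desc)) ⟩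
    cyclotomic (p ∷ ps) x * cyclotomic ps x       ≡⟨ cyclotomic-∷ desc x 1<x ⟩
    cyclotomic ps (x ^ p) {{m^n≢0 x p}}           ≤⟨ cyclotomic-upper ps (x ^ p) {{m^n≢0 x p}}
                                                       (1<x⇒1<x^p 1<x pp) (descending-tail desc) ⟩
    suc (x ^ p) ^ f                               ≤⟨ ^-monoˡ-≤ f (x^p+1≤[x-1]*[x+1]^[p-1] v r) ⟩
    (w * suc x ^ (2 + r)) ^ f                     ≡⟨ cong (_^ f) (*-comm w _) ⟩
    (suc x ^ (2 + r) * w) ^ f                     ≡⟨ ^-distribʳ-* f _ w ⟩
    (suc x ^ (2 + r)) ^ f * w ^ f                 ≡⟨ cong (_* w ^ f) (^-*-assoc (suc x) (2 + r) f) ⟩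
    suc x ^ ((2 + r) * f) * w ^ f                 ∎)
    where
    open ≤-Reasoning
    f = totient ps

-- Prime factors of cyclotomic values.

coprime-∤ : ∀ {p n} → Prime p → ¬ p ∣ n → Coprime n p
coprime-∤ pp p∤n (c∣n , c∣p) with prime⇒irreducible pp c∣p
... | inj₁ c≡1  = c≡1
... | inj₂ refl = contradiction c∣n p∤n

prime∣triangle : ∀ {p} → Prime p → 2 < p → p ∣ triangle p
prime∣triangle {suc p} pp 2<p
  with euclidsLemma 2 _ pp (subst (suc p ∣_) (sym (2*triangle p)) (m∣m*n p))
... | inj₁ p∣2 = contradiction p∣2 (>⇒∤ 2<p)
... | inj₂ p∣t = p∣t

4∤1+s² : ∀ s → ¬ 4 ∣ 1 + s * s
4∤1+s² s 4∣ = go (s % 4) (m%n<n s 4) (n∣m⇒m%n≡0 _ 4 (∣m+n∣m⇒∣n (subst (4 ∣_) eq 4∣) (n∣m*n c)))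
  where
  r = s % 4
  q = s / 4
  c = 2 * r * q + 4 * q * q
  rearrange : ∀ r q → 1 + (r + q * 4) * (r + q * 4) ≡ (2 * r * q + 4 * q * q) * 4 + (1 + r * r)
  rearrange = solve-∀
  eq : 1 + s * s ≡ c * 4 + (1 + r * r)
  eq = trans (cong (λ z → 1 + z * z) (m≡m%n+[m/n]*n s 4)) (rearrange r q)
  go : ∀ r → r < 4 → (1 + r * r) % 4 ≢ 0
  go 0 _ ()
  go 1 _ ()
  go 2 _ ()
  go 3 _ ()
  go (suc (suc (suc (suc _)))) (s≤s (s≤s (s≤s (s≤s ()))))

∣geometric⇒∣ : ∀ {n} B p → n ∣ B → n ∣ geometric (suc B) p → n ∣ p
∣geometric⇒∣ {n} B p n∣B n∣g with geometric-expansion B p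
... | c , eq = ∣m+n∣m⇒∣n (subst (n ∣_) (trans eq (+-comm p _)) n∣g)
  (∣m∣n⇒∣m+n (∣m⇒∣m*n _ n∣B) (∣m⇒∣m*n c (∣m⇒∣m*n B n∣B)))

²∤geometric : ∀ {p} B → Prime p → 2 < p → p ∣ B → ¬ p * p ∣ geometric (suc B) p
²∤geometric {p} B pp 2<p p∣B p²∣g with geometric-expansion B p
... | c , eq = contradiction (prime>1 pp)
  (≤⇒≯ (*-cancelˡ-≤ p (≤-trans (∣⇒≤ p²∣p) (≤-reflexive (sym (*-identityʳ p))))))
  where
  instance
    p≢0 : NonZero p
    p≢0 = prime⇒nonZero pp
  p²∣p : p * p ∣ p
  p²∣p = ∣m+n∣m⇒∣n (subst (p * p ∣_) (trans eq (+-comm p _)) p²∣g)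
    (∣m∣n⇒∣m+n (*-pres-∣ p∣B (prime∣triangle pp 2<p)) (∣m⇒∣m*n c (*-pres-∣ p∣B p∣B)))

-- Fermat's theorem and the gcd of exponents. The exponent `gcd d (l ∸ 1)` does duty for the
-- multiplicative order of `a` modulo `l`.
prime∣^∸1-gcd : ∀ {l} a .{{_ : NonZero a}} d .{{_ : NonZero d}} → Prime l → l ∣ a ^ d ∸ 1 →
  l ∣ a ^ gcd d (l ∸ 1) ∸ 1
prime∣^∸1-gcd {l} a d pl l∣a^d∸1 = ∣^∸1-gcd a d (l ∸ 1) l∣a^d∸1 (fermat pl a l∤a)
  where
  l∤a : ¬ l ∣ a
  l∤a l∣a = contradiction (∣1⇒≡1 (∣m+n∣m⇒∣n (subst (l ∣_) (trans (sym (suc[^∸1] a d)) (+-comm 1 _))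
      (∣-trans l∣a (subst (λ e → a ∣ a ^ e) (suc-pred d) (m∣m*n (a ^ pred d))))) l∣a^d∸1))
    (>⇒≢ (prime>1 pl))

-- Equivalently, Q divides the value at a of the d-th cyclotomic polynomial.
record Cyclotomic (a d Q : ℕ) : Set where
  field
    ∣-^∸1 : Q ∣ a ^ d ∸ 1
    *-∣   : ∀ {p} m → Prime p → m * p ≡ d → Q * (a ^ m ∸ 1) ∣ a ^ d ∸ 1

module _ {a d Q} (1<a : 1 < a) (2<d : 2 < d) (cyc : Cyclotomic a d Q) where
  open Cyclotomic cyc
  private instance
    a≢0 : NonZero a
    a≢0 = >-nonZero (<-trans z<s 1<a)
    d≢0 : NonZero d
    d≢0 = >-nonZero (<-trans z<s 2<d)

  ∣geometric : ∀ {p} m → Prime p → m * p ≡ d → Q ∣ geometric (a ^ m) p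
  ∣geometric {p} m pp refl = *-cancelʳ-∣ (a ^ m ∸ 1) {{^∸1-nonZero a m 1<a {{m*n≢0⇒m≢0 m}}}}
    (subst (Q * (a ^ m ∸ 1) ∣_)
      (trans (cong (_∸ 1) (sym (^-*-assoc a m p))) (sym (geometric-*-∸1 (a ^ m) {{m^n≢0 a m}} p)))
      (*-∣ m pp refl))

  -- `Q` divides (a ^ d - 1) / (a ^ m - 1) = 1 + a ^ m + ..., a sum of p terms that are all 1 modulo
  -- `l`.
  ∣imprimitive⇒∣ : ∀ {l p} m → Prime p → m * p ≡ d → l ∣ Q → l ∣ a ^ m ∸ 1 → l ∣ p
  ∣imprimitive⇒∣ {l} {p} m pp eq l∣Q l∣m = ∣geometric⇒∣ (a ^ m ∸ 1) p l∣m
    (subst (λ A → l ∣ geometric A p) (sym (suc[^∸1] a m)) (∣-trans l∣Q (∣geometric m pp eq)))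

  ∣gcd : ∀ {l} → Prime l → l ∣ Q → l ∣ a ^ gcd d (l ∸ 1) ∸ 1
  ∣gcd pl l∣Q = prime∣^∸1-gcd a d pl (∣-trans l∣Q ∣-^∸1)

  -- If p does not divide l - 1, then gcd(d, l - 1) divides d / p, so `l` divides a ^ (d / p) - 1
  -- and hence p.
  ∣⇒≡⊎∣∸1 : ∀ {l p} → Prime l → Prime p → l ∣ Q → p ∣ d → p ≡ l ⊎ p ∣ l ∸ 1
  ∣⇒≡⊎∣∸1 {l} {p} pl pp l∣Q (divides m eq) with p ∣? l ∸ 1
  ... | yes p∣ = inj₂ p∣
  ... | no p∤  = inj₁ (sym (prime-∣prime⇒≡ pl pp (∣imprimitive⇒∣ m pp (sym eq) l∣Q
    (∣-trans (∣gcd pl l∣Q) (^∸1-mono-∣ a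
      (coprime-divisor (coprime-∤ pp (λ p∣g → p∤ (∣-trans p∣g (gcd[m,n]∣n d (l ∸ 1)))))
        (subst (gcd d (l ∸ 1) ∣_) (trans eq (*-comm m p)) (gcd[m,n]∣m d (l ∸ 1)))))))))

  -- Write d = h gcd(d, l - 1). A prime p dividing h would make `l` divide a ^ (d / p) - 1, hence be
  -- p itself and divide d. So h = 1.
  ∤⇒∣∸1 : ∀ {l} → Prime l → l ∣ Q → ¬ l ∣ d → d ∣ l ∸ 1
  ∤⇒∣∸1 {l} pl l∣Q l∤d with gcd[m,n]∣m d (l ∸ 1) | ∣gcd pl l∣Q
  ... | divides 0 eq | _ = contradiction eq (≢-nonZero⁻¹ d)
  ... | divides 1 eq | _ = subst (_∣ l ∸ 1) (sym (trans eq (*-identityˡ _))) (gcd[m,n]∣n d (l ∸ 1))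
  ... | divides h@(suc (suc _)) eq | l∣g with ∃-primeDivisor h (s<s z<s)
  ... | p , pp , divides h′ eq′ = contradiction (divides m (trans (sym m*p≡d) (cong (m *_) (sym l≡p)))) l∤d
    where
    g = gcd d (l ∸ 1)
    m = h′ * g
    m*p≡d : m * p ≡ d
    m*p≡d = begin
      h′ * g * p    ≡⟨ *-assoc h′ g p ⟩
      h′ * (g * p)  ≡⟨ cong (h′ *_) (*-comm g p) ⟩
      h′ * (p * g)  ≡⟨ *-assoc h′ p g ⟨
      h′ * p * g    ≡⟨ cong (_* g) eq′ ⟨
      h * g         ≡⟨ eq ⟨
      d             ∎
      where open ≡-Reasoning
    l≡p : l ≡ p
    l≡p = prime-∣prime⇒≡ pl pp (∣imprimitive⇒∣ m pp m*p≡d l∣Q (∣-trans l∣g (^∸1-mono-∣ a {g} (n∣m*n h′))))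

  -- With m = d / l: for odd `l`, Fermat gives a ^ m ≡ a ^ d ≡ 1 modulo `l`, and the geometric sum
  -- is not divisible by l ^ 2. For l = 2, d > 2 forces m > 1; a prime factor of m can only be 2, so
  -- a ^ m is a square and a ^ m + 1 is not divisible by 4.
  ∣⇒²∤ : ∀ {l} → Prime l → l ∣ Q → l ∣ d → ¬ l * l ∣ Q
  ∣⇒²∤ {l} pl l∣Q (divides m eq) l²∣Q with l ≤? 2
  ... | no l≰2 = ²∤geometric (a ^ m ∸ 1) pl (≰⇒> l≰2) l∣A∸1
    (subst (λ A → l * l ∣ geometric A l) (sym (suc[^∸1] a m)) (∣-trans l²∣Q (∣geometric m pl (sym eq))))
    where
    l∣A∸1 : l ∣ a ^ m ∸ 1
    l∣A∸1 with fermat-^p pl (a ^ m)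
    ... | c , eq′ = ∣m+n∣m⇒∣n (subst (l ∣_) (suc-injective (begin
        suc (a ^ d ∸ 1)              ≡⟨ suc[^∸1] a d ⟩
        a ^ d                        ≡⟨ cong (a ^_) eq ⟩
        a ^ (m * l)                  ≡⟨ ^-*-assoc a m l ⟨
        (a ^ m) ^ l                  ≡⟨ eq′ ⟩
        a ^ m + l * c                ≡⟨ +-comm (a ^ m) (l * c) ⟩
        l * c + a ^ m                ≡⟨ cong (l * c +_) (suc[^∸1] a m) ⟨
        l * c + suc (a ^ m ∸ 1)      ≡⟨ +-suc (l * c) _ ⟩
        suc (l * c + (a ^ m ∸ 1))    ∎)) (∣-trans l∣Q ∣-^∸1)) (m∣m*n c)
      where open ≡-Reasoning
  ... | yes l≤2 with ≤-antisym l≤2 (prime>1 pl)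
  ... | refl with ∃-primeDivisor m (*-cancelʳ-< 2 1 m (<-≤-trans 2<d (≤-reflexive eq)))
  ... | p , pp , p∣m@(divides h eq′)
    with ∣⇒≡⊎∣∸1 pl pp l∣Q (∣-trans p∣m (divides 2 (trans eq (*-comm m 2))))
  ... | inj₂ p∣1  = contradiction (∣1⇒≡1 p∣1) (>⇒≢ (prime>1 pp))
  ... | inj₁ refl = 4∤1+s² (a ^ h) (subst (4 ∣_) A+1≡s²+1 (∣-trans l²∣Q (∣geometric m pl (sym eq))))
    where
    A+1≡s²+1 : geometric (a ^ m) 2 ≡ 1 + a ^ h * a ^ h
    A+1≡s²+1 = cong suc (begin
      a ^ m * (1 + a ^ m * 0)  ≡⟨ cong (λ z → a ^ m * (1 + z)) (*-zeroʳ (a ^ m)) ⟩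
      a ^ m * 1                ≡⟨ *-identityʳ (a ^ m) ⟩
      a ^ m                    ≡⟨ cong (a ^_) eq′ ⟩
      a ^ (h * 2)              ≡⟨ ^-*-assoc a h 2 ⟨
      (a ^ h) ^ 2              ≡⟨ cong (a ^ h *_) (*-identityʳ (a ^ h)) ⟩
      a ^ h * a ^ h            ∎)
      where open ≡-Reasoning

  -- Two different primes dividing both `Q` and `d` would each divide the other minus 1, which is
  -- impossible by size. So at most one prime has to be removed, and by `∣⇒²∤` only once.
  ∃-coprimePart : ∃[ l ] ∃[ M ] (Q ≡ M * l × (l ≡ 1 ⊎ (Prime l × l ∣ d)) × (∀ {q} → Prime q → q ∣ M → ¬ q ∣ d))
  ∃-coprimePart with gcd Q d in eq
  ... | 0 = contradiction (gcd[m,n]≡0⇒n≡0 Q eq) (≢-nonZero⁻¹ d)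
  ... | 1 = 1 , Q , sym (*-identityʳ Q) , inj₁ refl , λ pq q∣Q q∣d →
    contradiction (∣1⇒≡1 (subst (_ ∣_) eq (gcd-greatest q∣Q q∣d))) (>⇒≢ (prime>1 pq))
  ... | g@(suc (suc _)) with ∃-primeDivisor g (s<s z<s)
  ... | l , pl , l∣g with ∣-trans (subst (l ∣_) (sym eq) l∣g) (gcd[m,n]∣m Q d)
                        | ∣-trans (subst (l ∣_) (sym eq) l∣g) (gcd[m,n]∣n Q d)
  ... | l∣Q@(divides M Q≡M*l) | l∣d = l , M , Q≡M*l , inj₂ (pl , l∣d) , coprime
    where
    ∸1<⇒ : ∀ {p q} → Prime q → p ∣ q ∸ 1 → p < q
    ∸1<⇒ {p} {suc (suc q)} pq p∣ = s≤s (∣⇒≤ p∣)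
    ∸1<⇒ {p} {1} pq _ = contradiction pq ¬prime[1]
    ∸1<⇒ {p} {0} pq _ = contradiction pq ¬prime[0]
    coprime : ∀ {q} → Prime q → q ∣ M → ¬ q ∣ d
    coprime {q} pq q∣M q∣d with ∣⇒≡⊎∣∸1 pl pq l∣Q q∣d
    ... | inj₁ refl = ∣⇒²∤ pl l∣Q l∣d (subst (q * q ∣_) (sym Q≡M*l) (*-monoˡ-∣ q q∣M))
    ... | inj₂ q∣l∸1 with ∣⇒≡⊎∣∸1 pq pl (∣-trans q∣M (divides l (trans Q≡M*l (*-comm M l)))) l∣d
    ... | inj₁ refl  = <-irrefl refl (∸1<⇒ pl q∣l∸1)
    ... | inj₂ l∣q∸1 = <-asym (∸1<⇒ pl q∣l∸1) (∸1<⇒ pq l∣q∸1)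

-- The primitive part of `a ^ d ∸ 1`.

∣product∸1 : ∀ {d} ps → All (λ p → 0 < p × d ∣ p ∸ 1) ps → d ∣ product ps ∸ 1
∣product∸1 []       []               = _ ∣0
∣product∸1 {d} (suc p ∷ ps) ((_ , d∣p) ∷ h) with product ps | ∣product∸1 ps h
... | zero  | _   = subst (λ z → d ∣ z ∸ 1) (sym (*-zeroʳ p)) (d ∣0)
... | suc P | d∣P = ∣m∣n⇒∣m+n d∣P (∣m⇒∣m*n (suc P) d∣p)

-- `divisors` has two uses: g = M gives the congruence for the new exponent, and a common divisor g
-- > 1 of M and n is forced above d.
record PrimitivePart (a d M : ℕ) : Set where
  field
    ∣-^∸1     : M ∣ a ^ d ∸ 1
    divisors : ∀ {g} → g ∣ M → d ∣ g ∸ 1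

∃-primitivePart : ∀ {a d Q} → 1 < a → 2 < d → Cyclotomic a d Q →
  ∃[ l ] ∃[ M ] (Q ≡ M * l × (l ≡ 1 ⊎ (Prime l × l ∣ d)) × PrimitivePart a d M)
∃-primitivePart {a} {d} {Q} 1<a 2<d cyc with ∃-coprimePart 1<a 2<d cyc
... | l , M , Q≡M*l , hl , hM = l , M , Q≡M*l , hl , record
  { ∣-^∸1     = ∣-trans M∣Q ∣-^∸1
  ; divisors = λ {g} g∣M → all-divisors g g∣M
  }
  where
  open Cyclotomic cyc
  M∣Q : M ∣ Q
  M∣Q = divides l (trans Q≡M*l (*-comm M l))
  all-divisors : ∀ g → g ∣ M → d ∣ g ∸ 1
  all-divisors zero        _   = _ ∣0
  all-divisors g@(suc _) g∣M = subst (λ z → d ∣ z ∸ 1) (sym isFactorisation)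
    (∣product∸1 factors (All.tabulate λ {q} q∈ →
      let pq = All.lookup factorsPrime q∈
          q∣M = ∣-trans (subst (q ∣_) (sym isFactorisation) (∈⇒∣product q∈)) g∣M
      in <-trans z<s (prime>1 pq) , ∤⇒∣∸1 1<a 2<d cyc pq (∣-trans q∣M M∣Q) (hM pq q∣M)))
    where open PrimeFactorisation (factorise g)

-- From squarefree to arbitrary index.

primeDivisors : ℕ → List ℕ
primeDivisors d = filter (λ p → p ∣? d ×-dec prime? p) (downFrom (suc d))

downFrom-descending : ∀ n → AllPairs _>_ (downFrom n)
downFrom-descending n = AllPairs.applyDownFrom⁺₁ _ n λ j<i _ → j<i

primeDivisors-all : ∀ d → All (λ p → p ∣ d × Prime p) (primeDivisors d)
primeDivisors-all d = All.all-filter (λ p → p ∣? d ×-dec prime? p) (downFrom (suc d))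

primeDivisors-descending : ∀ d → DescendingPrimes (primeDivisors d)
primeDivisors-descending d = All.map proj₂ (primeDivisors-all d) ,
  AllPairs.filter⁺ (λ p → p ∣? d ×-dec prime? p) (downFrom-descending (suc d))

∈-primeDivisors : ∀ {p d} .{{_ : NonZero d}} → Prime p → p ∣ d → p ∈ primeDivisors d
∈-primeDivisors {p} {d} pp p∣d = ∈-filter⁺ (λ p → p ∣? d ×-dec prime? p)
  (∈-downFrom⁺ (s≤s (∣⇒≤ p∣d))) (p∣d , pp)

descending-product∣ : ∀ {d} ps → DescendingPrimes ps → All (_∣ d) ps → product ps ∣ d
descending-product∣ []       _    _            = 1∣ _
descending-product∣ {d} (p ∷ ps) desc@(pp ∷ _ , p>ps ∷ _) (p∣d ∷ ps∣d)
  with descending-product∣ ps (descending-tail desc) ps∣d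
... | divides k eq with euclidsLemma k (product ps) pp (subst (p ∣_) eq p∣d)
... | inj₁ p∣k = subst (p * product ps ∣_) (sym eq) (*-monoˡ-∣ (product ps) p∣k)
... | inj₂ p∣P = contradiction
  (All.lookup p>ps (factorisationHasAllPrimeFactors pp p∣P (proj₁ (descending-tail desc)))) (<-irrefl refl)

product-primeDivisors∣ : ∀ d → product (primeDivisors d) ∣ d
product-primeDivisors∣ d = descending-product∣ (primeDivisors d) (primeDivisors-descending d)
  (All.map proj₁ (primeDivisors-all d))

-- As u = d / rad(d), the d-th cyclotomic polynomial at `a` is the one of index rad(d) at a ^ u.
-- Each a ^ (d / p) - 1 divides the lcm `L` with Q L = a ^ d - 1.
cyclotomic-isCyclotomic : ∀ a .{{_ : NonZero a}} u d .{{_ : NonZero d}} → d ≡ u * product (primeDivisors d) →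
  Cyclotomic a d (cyclotomic (primeDivisors d) (a ^ u) {{m^n≢0 a u}})
cyclotomic-isCyclotomic a u d eq = record
  { ∣-^∸1 = subst (Q ∣_) Q*L≡ (m∣m*n L)
  ; *-∣   = multiple
  }
  where
  instance
    a^u≢0 : NonZero (a ^ u)
    a^u≢0 = m^n≢0 a u
  ps = primeDivisors d
  P = product ps
  Q = cyclotomic ps (a ^ u)
  L = properLcm ps (a ^ u)
  Q*L≡ : Q * L ≡ a ^ d ∸ 1
  Q*L≡ = trans (cyclotomic-*-properLcm ps (a ^ u))
    (cong (_∸ 1) (trans (^-*-assoc a u P) (cong (a ^_) (sym eq))))
  multiple : ∀ {p} m → Prime p → m * p ≡ d → Q * (a ^ m ∸ 1) ∣ a ^ d ∸ 1
  multiple {p} m pp m*p≡d with ∈-primeDivisors pp (divides m (sym m*p≡d))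
  ... | p∈ps with ∈⇒∣product p∈ps
  ... | divides m′ eq′ = subst (Q * (a ^ m ∸ 1) ∣_) Q*L≡ (*-monoʳ-∣ Q
    (subst (λ z → z ∸ 1 ∣ L) (trans (^-*-assoc a u m′) (cong (a ^_) (sym m≡u*m′)))
      (∈⇒^∸1∣properLcm m′ (a ^ u) (proj₁ (primeDivisors-descending d)) p∈ps (sym eq′))))
    where
    m≡u*m′ : m ≡ u * m′
    m≡u*m′ = *-cancelʳ-≡ m (u * m′) p {{prime⇒nonZero pp}}
      (trans m*p≡d (trans eq (trans (cong (u *_) eq′) (sym (*-assoc u m′ p)))))

-- Numerical estimates.

totient-nonZero : ∀ {ps} → All Prime ps → NonZero (totient ps)
totient-nonZero []         = _
totient-nonZero {suc (suc p) ∷ ps} (_ ∷ pps) = m*n≢0 (suc p) (totient ps) {{_}} {{totient-nonZero pps}}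
totient-nonZero {1 ∷ _} (pp ∷ _) = contradiction pp ¬prime[1]
totient-nonZero {0 ∷ _} (pp ∷ _) = contradiction pp ¬prime[0]

-- Trades `product ps` for a quadratic in `totient ps`, the exponent in the lower bound. The
-- induction rests on p f (f + 1) ≤ (p - 1) f ((p - 1) f + 1) for p ≥ 3 and f ≥ 1.
product≤totient*[1+totient] : ∀ ps → DescendingPrimes ps → product ps ≤ totient ps * suc (totient ps)
product≤totient*[1+totient] []         _ = s≤s z≤n
product≤totient*[1+totient] (0 ∷ ps) (pp ∷ _ , _) = contradiction pp ¬prime[0]
product≤totient*[1+totient] (1 ∷ ps) (pp ∷ _ , _) = contradiction pp ¬prime[1]
product≤totient*[1+totient] (2 ∷ ps) desc rewrite descending-[2] desc = s≤s (s≤s z≤n)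
product≤totient*[1+totient] (suc (suc (suc r)) ∷ ps) desc =
  step (totient ps) {{totient-nonZero (proj₁ (descending-tail desc))}}
    (product≤totient*[1+totient] ps (descending-tail desc))
  where
  open ≤-Reasoning
  rearrange : ∀ r g → (3 + r) * (suc g * (2 + g)) + suc g * (g + (1 + g) * (3 * r + r * r))
                    ≡ (2 + r) * suc g * suc ((2 + r) * suc g)
  rearrange = solve-∀
  step : ∀ f .{{_ : NonZero f}} → product ps ≤ f * suc f →
         (3 + r) * product ps ≤ (2 + r) * f * suc ((2 + r) * f)
  step (suc g) ih = begin
    (3 + r) * product ps               ≤⟨ *-monoʳ-≤ (3 + r) ih ⟩
    (3 + r) * (suc g * (2 + g))        ≤⟨ m≤m+n _ _ ⟩
    (3 + r) * (suc g * (2 + g)) + suc g * (g + (1 + g) * (3 * r + r * r)) ≡⟨ rearrange r g ⟩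
    (2 + r) * suc g * suc ((2 + r) * suc g)  ∎

head₀ : List ℕ → ℕ
head₀ []      = 0
head₀ (p ∷ _) = p

-- Plain arithmetic that stays below `cyclotomic ps y`, fit for evaluation in finite checks. The
-- fallback 0 is the trivial lower bound.
cyclotomicBound : List ℕ → ℕ → ℕ
cyclotomicBound (2 ∷ _)                      y = suc y
cyclotomicBound (suc (suc (suc r)) ∷ ps)     y = (y ^ suc r * (y ∸ 1)) ^ totient ps
cyclotomicBound _                            y = 0

cyclotomicBound≤cyclotomic : ∀ ps y .{{_ : NonZero y}} → 1 < y → DescendingPrimes ps →
  cyclotomicBound ps y ≤ cyclotomic ps y
cyclotomicBound≤cyclotomic []       y 1<y desc = z≤n
cyclotomicBound≤cyclotomic (0 ∷ ps) y 1<y desc = z≤n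
cyclotomicBound≤cyclotomic (1 ∷ ps) y 1<y desc = z≤n
cyclotomicBound≤cyclotomic (2 ∷ ps) y 1<y desc rewrite descending-[2] desc =
  ≤-reflexive (sym (cyclotomic-[2] y 1<y))
cyclotomicBound≤cyclotomic (suc (suc (suc r)) ∷ ps) y 1<y desc = cyclotomic-∷-lower r ps y 1<y desc

cyclotomicBound-mono : ∀ ps {y z} → y ≤ z → cyclotomicBound ps y ≤ cyclotomicBound ps z
cyclotomicBound-mono []       y≤z = z≤n
cyclotomicBound-mono (0 ∷ ps) y≤z = z≤n
cyclotomicBound-mono (1 ∷ ps) y≤z = z≤n
cyclotomicBound-mono (2 ∷ ps) y≤z = s≤s y≤z
cyclotomicBound-mono (suc (suc (suc r)) ∷ ps) y≤z =
  ^-monoˡ-≤ (totient ps) (*-mono-≤ (^-monoˡ-≤ (suc r) y≤z) (∸-monoˡ-≤ 1 y≤z))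

cofactor : ℕ → ℕ
cofactor d = (d / product (primeDivisors d)) {{productOfPrimes≢0 (proj₁ (primeDivisors-descending d))}}

cofactor-* : ∀ d → d ≡ cofactor d * product (primeDivisors d)
cofactor-* d = sym (m/n*n≡m {{productOfPrimes≢0 (proj₁ (primeDivisors-descending d))}} (product-primeDivisors∣ d))

-- The d-th cyclotomic value is M l with l at most the largest prime factor of d, so this inequality
-- forces M > 2 d + 1. The base `b` is a lower bound for `a`, so that one check serves every larger
-- base.
Sufficient : ℕ → ℕ → Set
Sufficient b d = (2 * d + 1) * head₀ (primeDivisors d) < cyclotomicBound (primeDivisors d) (b ^ cofactor d)

sufficient? : ∀ b d → Dec (Sufficient b d)
sufficient? b d = _ <? _

8u+1<2^u : ∀ v → (let u = 6 + v) → 8 * u + 1 < 2 ^ u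
8u+1<2^u zero    = from-yes (49 <? 64)
8u+1<2^u (suc v) = begin-strict
  8 * (7 + v) + 1            ≤⟨ m≤m+n _ (8 * v + 41) ⟩
  8 * (7 + v) + 1 + (8 * v + 41)    ≡⟨ rearrange v ⟩
  2 * (8 * (6 + v) + 1)      <⟨ *-monoʳ-< 2 (8u+1<2^u v) ⟩
  2 ^ (7 + v)                ∎
  where
  open ≤-Reasoning
  rearrange : ∀ v → 8 * (7 + v) + 1 + (8 * v + 41) ≡ 2 * (8 * (6 + v) + 1)
  rearrange = solve-∀

-- If d = u p P, where P is a product of distinct primes below the prime p, then this is an upper bound
-- for (2 d + 1) p in terms of s = u (p − 1) and f = φ(P).
cubicBound : ℕ → ℕ → ℕ
cubicBound s f = 2 * (s * (3 + s)) * (f * suc f) + suc s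

-- Raising f by 1 at most triples `cubicBound s f`, while the right side gains a factor X ≥ 3.
cubicBound-f : ∀ s X → 3 ≤ X → ∀ f₀ → cubicBound s (suc f₀) < X ^ suc f₀ →
  ∀ k → cubicBound s (k + suc f₀) < X ^ (k + suc f₀)
cubicBound-f s X 3≤X f₀ base zero    = base
cubicBound-f s X 3≤X f₀ base (suc k) rewrite +-suc k f₀ = begin-strict
  cubicBound s (2 + g)
    ≤⟨ m≤m+n _ (2 * (s * (3 + s)) * ((2 + g) * (2 * g)) + 2 * suc s) ⟩
  cubicBound s (2 + g) + (2 * (s * (3 + s)) * ((2 + g) * (2 * g)) + 2 * suc s)
    ≡⟨ rearrange s g ⟩
  3 * cubicBound s (1 + g)
    <⟨ *-monoʳ-< 3 (subst (λ f → cubicBound s f < X ^ f) (+-suc k f₀) (cubicBound-f s X 3≤X f₀ base k)) ⟩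
  3 * X ^ (1 + g)
    ≤⟨ *-monoˡ-≤ (X ^ (1 + g)) 3≤X ⟩
  X ^ (2 + g) ∎
  where
  open ≤-Reasoning
  g = k + f₀
  rearrange : ∀ s g → 2 * (s * (3 + s)) * ((2 + g) * (3 + g)) + suc s
                        + (2 * (s * (3 + s)) * ((2 + g) * (2 * g)) + 2 * suc s)
                    ≡ 3 * (2 * (s * (3 + s)) * ((1 + g) * (2 + g)) + suc s)
  rearrange = solve-∀

-- At t = 9 the inequality fails, 531 against 512; from t = 10 on each step at most doubles the left
-- side.
cubicBound-1 : ∀ {t} → 10 ≤′ t → cubicBound (suc t) 1 < 2 ^ t
cubicBound-1 ≤′-refl = from-yes (cubicBound 11 1 <? 2 ^ 10)
cubicBound-1 (≤′-step {zero}  10≤0) = contradiction (≤′⇒≤ 10≤0) λ ()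
cubicBound-1 (≤′-step {suc v} 10≤t) = begin-strict
  cubicBound (3 + v) 1                              ≤⟨ m≤m+n _ (4 * v * v + 21 * v + 10) ⟩
  cubicBound (3 + v) 1 + (4 * v * v + 21 * v + 10)  ≡⟨ rearrange v ⟩
  2 * cubicBound (2 + v) 1                          <⟨ *-monoʳ-< 2 (cubicBound-1 10≤t) ⟩
  2 * 2 ^ suc v                                     ∎
  where
  open ≤-Reasoning
  rearrange : ∀ v → 2 * ((3 + v) * (3 + (3 + v))) * 2 + suc (3 + v) + (4 * v * v + 21 * v + 10)
                  ≡ 2 * (2 * ((2 + v) * (3 + (2 + v))) * 2 + suc (2 + v))
  rearrange = solve-∀

cubicBound-4 : ∀ {t} → t < 7 → cubicBound (4 + t) 4 < (2 ^ (3 + t)) ^ 4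
cubicBound-4 = from-yes (allUpTo? (λ t → cubicBound (4 + t) 4 <? (2 ^ (3 + t)) ^ 4) 7)

3≤2^[2+n] : ∀ n → 3 ≤ 2 ^ (2 + n)
3≤2^[2+n] n = ≤-trans (from-yes (3 ≤? 4)) (^-monoʳ-≤ 2 {2} {2 + n} (m≤m+n 2 n))

cubicBound<-large : ∀ t f .{{_ : NonZero f}} → 11 ≤ suc t → cubicBound (suc t) f < (2 ^ t) ^ f
cubicBound<-large t (suc f) (s≤s 10≤t) = subst (λ e → cubicBound (suc t) e < (2 ^ t) ^ e) (+-comm f 1)
  (cubicBound-f (suc t) (2 ^ t) (3≤2^ 10≤t) 0 base f)
  where
  3≤2^ : ∀ {t} → 10 ≤ t → 3 ≤ 2 ^ t
  3≤2^ 10≤t with m≤n⇒∃[o]m+o≡n (≤-trans (m≤m+n 2 8) 10≤t)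
  ... | o , refl = 3≤2^[2+n] o
  base : cubicBound (suc t) 1 < (2 ^ t) ^ 1
  base = <-≤-trans (cubicBound-1 (≤⇒≤′ 10≤t)) (≤-reflexive (sym (*-identityʳ (2 ^ t))))

cubicBound<-small : ∀ t f → 4 ≤ suc t → suc t ≤ 10 → 4 ≤ f → cubicBound (suc t) f < (2 ^ t) ^ f
cubicBound<-small t f 4≤ ≤10 4≤f with m≤n⇒∃[o]m+o≡n 4≤ | m≤n⇒∃[o]m+o≡n 4≤f
... | o , refl | k , refl = subst (λ e → cubicBound (4 + o) e < (2 ^ (3 + o)) ^ e) (+-comm k 4)
  (cubicBound-f (4 + o) (2 ^ (3 + o)) (3≤2^[2+n] (1 + o)) 3
    (cubicBound-4 (+-cancelˡ-≤ 4 _ _ (≤-trans (≤-reflexive (+-suc 4 o)) (≤-trans (s≤s ≤10) ≤-refl)))) k)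

-- From 2 ^ u - 1 ≥ 2 ^ (u - 1). For k = p - 2 the exponent on the left is s - 1 with s = u (p - 1),
-- which bounds `cyclotomicBound` by (2 ^ (s - 1)) ^ f from below.
2^[uk+v]≤ : ∀ k v → (let u = suc v) → 2 ^ (u * k + v) ≤ (2 ^ u) ^ k * (2 ^ u ∸ 1)
2^[uk+v]≤ k v = begin
  2 ^ (u * k + v)            ≡⟨ ^-distribˡ-+-* 2 (u * k) v ⟩
  2 ^ (u * k) * 2 ^ v        ≡⟨ cong (_* 2 ^ v) (^-*-assoc 2 u k) ⟨
  (2 ^ u) ^ k * 2 ^ v        ≤⟨ *-monoʳ-≤ ((2 ^ u) ^ k) (∸-monoˡ-≤ {suc (2 ^ v)} 1
                                  (+-mono-≤ (m^n>0 2 v) (≤-reflexive (sym (+-identityʳ (2 ^ v)))))) ⟩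
  (2 ^ u) ^ k * (2 ^ u ∸ 1)  ∎
  where
  open ≤-Reasoning
  u = suc v

-- With p = 3 + r and s = u (p - 1): u p ^ 2 ≤ s (s + 3), because s + 3 ≥ p + 2 and (p - 1) (p + 2)
-- ≥ p ^ 2; also p ≤ s + 1.
[2d+1]p≤cubicBound : ∀ v r f P → P ≤ f * suc f → (let u = suc v) →
  (2 * (u * ((3 + r) * P)) + 1) * (3 + r) ≤ cubicBound (u * (2 + r)) f
[2d+1]p≤cubicBound v r f P P≤ = begin
  (2 * (u * ((3 + r) * P)) + 1) * (3 + r)                  ≡⟨ rearrange₁ u r P ⟩
  2 * (u * ((3 + r) * (3 + r))) * P + (3 + r)              ≤⟨ +-mono-≤ (*-mono-≤ (*-monoʳ-≤ 2 le₁) P≤) le₂ ⟩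
  2 * (s * (3 + s)) * (f * suc f) + suc s                  ∎
  where
  open ≤-Reasoning
  u = suc v
  s = u * (2 + r)
  rearrange₁ : ∀ u r P → (2 * (u * ((3 + r) * P)) + 1) * (3 + r) ≡ 2 * (u * ((3 + r) * (3 + r))) * P + (3 + r)
  rearrange₁ = solve-∀
  rearrange₂ : ∀ v r → suc v * ((3 + r) * (3 + r)) + suc v * (suc r + v * ((2 + r) * (2 + r)))
                     ≡ suc v * (2 + r) * (3 + suc v * (2 + r))
  rearrange₂ = solve-∀
  le₁ : u * ((3 + r) * (3 + r)) ≤ s * (3 + s)
  le₁ = ≤-trans (m≤m+n _ _) (≤-reflexive (rearrange₂ v r))
  le₂ : 3 + r ≤ suc s
  le₂ = s≤s (m≤n*m (2 + r) u)

¬prime[4] : ¬ Prime 4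
¬prime[4] = from-no (prime? 4)

totient-below-3 : ∀ ps → DescendingPrimes (3 ∷ ps) → totient ps ≡ 1
totient-below-3 []       _ = refl
totient-below-3 (0 ∷ ps) (_ ∷ pp ∷ _ , _) = contradiction pp ¬prime[0]
totient-below-3 (1 ∷ ps) (_ ∷ pp ∷ _ , _) = contradiction pp ¬prime[1]
totient-below-3 (2 ∷ ps) desc rewrite descending-[2] (descending-tail desc) = refl
totient-below-3 (suc (suc (suc _)) ∷ ps) (_ , (s≤s (s≤s (s≤s ())) ∷ _) ∷ _)

-- For an odd largest prime p put s = u (p - 1). The estimate is known for s ≥ 11, and for 4 ≤ s ≤
-- 10 with f ≥ 4. If s ≤ 10 and f ≤ 3, then P ≤ 12 and p ≤ 3 (p - 1) / 2 give d ≤ 180, whence the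
-- constant 181. If s ≤ 3, then p = 3 and f = 1.
cyclotomicBound-large : ∀ ps v → (let u = suc v) → DescendingPrimes ps → 181 ≤ u * product ps →
  ps ≢ [] → (2 * (u * product ps) + 1) * head₀ ps < cyclotomicBound ps (2 ^ u)
cyclotomicBound-large []       v desc 181≤ ne = contradiction refl ne
cyclotomicBound-large (0 ∷ ps) v (pp ∷ _ , _) 181≤ _ = contradiction pp ¬prime[0]
cyclotomicBound-large (1 ∷ ps) v (pp ∷ _ , _) 181≤ _ = contradiction pp ¬prime[1]
cyclotomicBound-large (2 ∷ ps) v desc 181≤ _ rewrite descending-[2] desc
  with m≤n⇒∃[o]m+o≡n (*-cancelʳ-≤ 6 (suc v) 2 (≤-trans (from-yes (12 ≤? 181)) 181≤))
... | o , refl = s≤s (≤-trans (≤-reflexive (rearrange (6 + o))) (8u+1<2^u o))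
  where
  rearrange : ∀ u → (2 * (u * 2) + 1) * 2 ≡ suc (8 * u + 1)
  rearrange = solve-∀
cyclotomicBound-large (suc (suc (suc r)) ∷ ps) v desc@(pp ∷ _ , _) 181≤ _ = begin-strict
  (2 * (u * ((3 + r) * P)) + 1) * (3 + r)   ≤⟨ [2d+1]p≤cubicBound v r f P
                                                   (product≤totient*[1+totient] ps (descending-tail desc)) ⟩
  cubicBound (u * (2 + r)) f                ≡⟨ cong (λ s → cubicBound s f) s≡ ⟩
  cubicBound (suc t) f                      <⟨ main ⟩
  (2 ^ t) ^ f                               ≤⟨ ^-monoˡ-≤ f (2^[uk+v]≤ (suc r) v) ⟩
  ((2 ^ u) ^ suc r * (2 ^ u ∸ 1)) ^ f       ∎
  where
  open ≤-Reasoning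
  u = suc v
  P = product ps
  f = totient ps
  t = u * suc r + v
  instance
    f≢0 : NonZero f
    f≢0 = totient-nonZero (proj₁ (descending-tail desc))
  s≡ : u * (2 + r) ≡ suc t
  s≡ = trans (*-suc u (suc r)) (cong suc (+-comm v _))
  main : cubicBound (suc t) f < (2 ^ t) ^ f
  main with 11 ≤? suc t | 4 ≤? f | 4 ≤? suc t
  ... | yes 11≤ | _ | _ = cubicBound<-large t f 11≤
  ... | no 11≰ | yes 4≤f | yes 4≤ = cubicBound<-small t f 4≤ (≤-pred (≰⇒> 11≰)) 4≤f
  ... | no 11≰ | no 4≰f | _ = contradiction 181≤ (<⇒≱ (s≤s (*-cancelˡ-≤ 2 (begin
      2 * (u * ((3 + r) * P))            ≡⟨ rearrange₁ u r P ⟩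
      u * (2 * (3 + r)) * P              ≤⟨ *-mono-≤ (*-monoʳ-≤ u
                                              (≤-trans (m≤m+n _ r) (≤-reflexive (rearrange₂ r)))) P≤12 ⟩
      u * (3 * (2 + r)) * 12             ≡⟨ rearrange₃ u r ⟩
      36 * (u * (2 + r))                 ≡⟨ cong (36 *_) s≡ ⟩
      36 * suc t                         ≤⟨ *-monoʳ-≤ 36 (≤-pred (≰⇒> 11≰)) ⟩
      2 * 180                            ∎))))
    where
    rearrange₁ : ∀ u r P → 2 * (u * ((3 + r) * P)) ≡ u * (2 * (3 + r)) * P
    rearrange₁ = solve-∀
    rearrange₂ : ∀ r → 2 * (3 + r) + r ≡ 3 * (2 + r)
    rearrange₂ = solve-∀
    rearrange₃ : ∀ u r → u * (3 * (2 + r)) * 12 ≡ 36 * (u * (2 + r))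
    rearrange₃ = solve-∀
    f≤3 : f ≤ 3
    f≤3 = ≤-pred (≰⇒> 4≰f)
    P≤12 : P ≤ 12
    P≤12 = ≤-trans (product≤totient*[1+totient] ps (descending-tail desc)) (*-mono-≤ f≤3 (s≤s f≤3))
  ... | no 11≰ | yes 4≤f | no 4≰ = ⊥-elim (tiny r desc
      (≤-trans (m≤n*m (2 + r) u) (≤-trans (≤-reflexive s≡) (≤-pred (≰⇒> 4≰)))))
    where
    tiny : ∀ r → DescendingPrimes (3 + r ∷ ps) → 2 + r ≤ 3 → ⊥
    tiny 0 desc _ = contradiction (totient-below-3 ps desc) (>⇒≢ (≤-trans (s≤s (s≤s z≤n)) 4≤f))
    tiny 1 (pp ∷ _ , _) _ = ¬prime[4] pp
    tiny (suc (suc _)) _ (s≤s (s≤s (s≤s ())))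

-- A quantitative form of Zsigmondy's theorem.

primeDivisors≢[] : ∀ d → 1 < d → primeDivisors d ≢ []
primeDivisors≢[] d 1<d eq with ∃-primeDivisor d 1<d
... | p , pp , p∣d = case subst (p ∈_) eq (∈-primeDivisors {{>-nonZero (<-trans z<s 1<d)}} pp p∣d) of λ ()

cofactor-nonZero : ∀ d .{{_ : NonZero d}} → NonZero (cofactor d)
cofactor-nonZero d = m*n≢0⇒m≢0 (cofactor d) {{subst NonZero (cofactor-* d) (>-nonZero (>-nonZero⁻¹ d))}}

sufficient-large : ∀ d → 181 ≤ d → Sufficient 2 d
sufficient-large d 181≤d = go (cofactor d) (cofactor-* d) (cofactor-nonZero d {{d≢0}})
  where
  d≢0 : NonZero d
  d≢0 = >-nonZero (≤-trans (s≤s z≤n) 181≤d)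
  ps = primeDivisors d
  go : ∀ u → d ≡ u * product ps → NonZero u → (2 * d + 1) * head₀ ps < cyclotomicBound ps (2 ^ u)
  go (suc v) eq _ = subst (λ n → (2 * n + 1) * head₀ ps < cyclotomicBound ps (2 ^ suc v)) (sym eq)
    (cyclotomicBound-large ps v (primeDivisors-descending d) (≤-trans 181≤d (≤-reflexive eq))
      (primeDivisors≢[] d (≤-trans (s≤s (s≤s z≤n)) 181≤d)))

∈⇒≤head₀ : ∀ {p} ps → DescendingPrimes ps → p ∈ ps → p ≤ head₀ ps
∈⇒≤head₀ (q ∷ ps) _ (here refl) = ≤-refl
∈⇒≤head₀ (q ∷ ps) (_ , q>ps ∷ _) (there p∈) = <⇒≤ (All.lookup q>ps p∈)

sufficient⇒∃-primitivePart : ∀ {b a d} → b ≤ a → 1 < a → 2 < d → Sufficient b d →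
  ∃[ M ] (PrimitivePart a d M × 2 * d + 1 < M)
sufficient⇒∃-primitivePart {b} {a} {d} b≤a 1<a 2<d suff
  with ∃-primitivePart 1<a 2<d (cyclotomic-isCyclotomic a {{>-nonZero (<-trans z<s 1<a)}}
         (cofactor d) d {{>-nonZero (<-trans z<s 2<d)}} (cofactor-* d))
... | l , M , Q≡M*l , hl , prim = M , prim , ≰⇒> λ M≤ → <⇒≱ suff (begin
  cyclotomicBound ps (b ^ u)   ≤⟨ cyclotomicBound-mono ps (^-monoˡ-≤ u b≤a) ⟩
  cyclotomicBound ps (a ^ u)   ≤⟨ cyclotomicBound≤cyclotomic ps (a ^ u) 1<a^u desc ⟩
  cyclotomic ps (a ^ u)        ≡⟨ Q≡M*l ⟩
  M * l                        ≤⟨ *-mono-≤ M≤ (l≤head hl) ⟩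
  (2 * d + 1) * head₀ ps       ∎)
  where
  open ≤-Reasoning
  instance
    a≢0 : NonZero a
    a≢0 = >-nonZero (<-trans z<s 1<a)
    d≢0 : NonZero d
    d≢0 = >-nonZero (<-trans z<s 2<d)
  u = cofactor d
  ps = primeDivisors d
  desc = primeDivisors-descending d
  instance
    a^u≢0 : NonZero (a ^ u)
    a^u≢0 = m^n≢0 a u
  1<a^u : 1 < a ^ u
  1<a^u = ^-monoʳ-< a 1<a (>-nonZero⁻¹ u {{cofactor-nonZero d}})
  l≤head : (l ≡ 1 ⊎ (Prime l × l ∣ d)) → l ≤ head₀ ps
  l≤head (inj₂ (pl , l∣d)) = ∈⇒≤head₀ ps desc (∈-primeDivisors pl l∣d)
  l≤head (inj₁ refl) with ∃-primeDivisor d (<-trans (s≤s (s≤s z≤n)) 2<d)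
  ... | p , pp , p∣d = ≤-trans (<⇒≤ (prime>1 pp)) (∈⇒≤head₀ ps desc (∈-primeDivisors pp p∣d))

-- 31 and 13 are the least bounds from which `Sufficient 2 d` and `Sufficient 3 d` hold throughout:
-- they fail at d = 30 and d = 12.
threshold : ℕ → ℕ
threshold 2 = 31
threshold _ = 13

sufficient-2 : ∀ d → 31 ≤ d → Sufficient 2 d
sufficient-2 d 31≤d with d <? 181
... | no d≮   = sufficient-large d (≮⇒≥ d≮)
... | yes d<  = from-yes (allUpTo? (λ d → 31 ≤? d →-dec sufficient? 2 d) 181) d< 31≤d

sufficient-3 : ∀ d → 13 ≤ d → d < 31 → Sufficient 3 d
sufficient-3 d 13≤d d< = from-yes (allUpTo? (λ d → 13 ≤? d →-dec sufficient? 3 d) 31) d< 13≤d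

-- For a ≥ 3 and d ≥ 31 the estimate at base 2 applies by monotonicity; only 13 ≤ d < 31 needs base
-- 3.
zsigmondy : ∀ {a d} → 1 < a → threshold a ≤ d → ∃[ M ] (PrimitivePart a d M × 2 * d + 1 < M)
zsigmondy {1} (s≤s ()) _
zsigmondy {2} {d} 1<a 31≤d = sufficient⇒∃-primitivePart ≤-refl 1<a
  (≤-trans (s≤s (s≤s (s≤s z≤n))) 31≤d) (sufficient-2 d 31≤d)
zsigmondy {suc (suc (suc a))} {d} 1<a 13≤d with d <? 31
... | yes d< = sufficient⇒∃-primitivePart (s≤s (s≤s (s≤s z≤n))) 1<a
  (≤-trans (s≤s (s≤s (s≤s z≤n))) 13≤d) (sufficient-3 d 13≤d d<)
... | no d≮ = sufficient⇒∃-primitivePart (s≤s (s≤s z≤n)) 1<a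
  (≤-trans (s≤s (s≤s (s≤s z≤n))) 13≤d) (sufficient-2 d (≮⇒≥ d≮))

-- From one solution to a larger one.

-- Imported only here because the constructor +_ would clash with the sections (m +_) above.
open import Data.Integer using (ℤ; +_; -[1+_]; _-_) renaming (∣_∣ to abs)
open import Data.Integer.Properties using (⊖-≥; m-n≡m⊖n)

-- A solution n with n − k = e for k = κ − j, where e is large enough for solution-step.
record Solution (a κ j n e : ℕ) : Set where
  field
    exponent    : n + j ≡ e + κ
    divides-^∸1 : n ∣ a ^ e ∸ 1
    κ≤e         : κ ≤ e
    threshold≤e : threshold a ≤ e

threshold≤31 : ∀ a → threshold a ≤ 31
threshold≤31 0                   = m≤m+n 13 18
threshold≤31 1                   = m≤m+n 13 18
threshold≤31 2                   = ≤-refl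
threshold≤31 (suc (suc (suc _))) = m≤m+n 13 18

-- A common divisor c > 1 exceeds e. If κ = 0 this contradicts c ≤ n ≤ e. If κ > 1 and j = 0, then n
-- = e + κ ≤ 2 e < 2 c leaves n = c, so e divides c - 1 = e + κ - 1 and thus κ - 1, which lies
-- strictly between 0 and e.
solution-coprime : ∀ {a κ j n e M} → κ ≡ 0 ⊎ (1 < κ × j ≡ 0) → 0 < n →
  Solution a κ j n e → PrimitivePart a e M → Coprime n M
solution-coprime {a} {κ} {j} {n} {e} hκ 0<n sol prim {c} (c∣n , c∣M)
  with c | c∣n | PrimitivePart.divisors prim c∣M
... | 0 | 0∣n | _ = contradiction (0∣⇒≡0 0∣n) (>⇒≢ 0<n)
... | 1 | _   | _ = refl
... | c@(suc (suc _)) | c∣n@(divides q n≡q*c) | e∣c∸1 = ⊥-elim (impossible hκ q n≡q*c)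
  where
  open Solution sol
  open ≤-Reasoning
  instance
    n≢0 : NonZero n
    n≢0 = >-nonZero 0<n
  e<c : e < c
  e<c = s≤s (∣⇒≤ e∣c∸1)
  e<n : e < n
  e<n = <-≤-trans e<c (∣⇒≤ c∣n)
  impossible : κ ≡ 0 ⊎ (1 < κ × j ≡ 0) → ∀ q → n ≡ q * c → ⊥
  impossible (inj₁ refl) _ _ = <⇒≱ e<n (≤-trans (m≤m+n n j) (≤-reflexive (trans exponent (+-identityʳ e))))
  impossible (inj₂ (1<κ , refl)) 0 eq = contradiction eq (>⇒≢ 0<n)
  impossible (inj₂ (1<κ , refl)) 1 eq = <⇒≱ (≤-trans (∸1< κ 1<κ) κ≤e) (∣⇒≤ {{>-nonZero (m<n⇒0<n∸m 1<κ)}} e∣κ∸1)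
    where
    ∸1< : ∀ κ → 1 < κ → κ ∸ 1 < κ
    ∸1< (suc _) _ = ≤-refl
    e∣κ∸1 : e ∣ κ ∸ 1
    e∣κ∸1 = ∣m+n∣m⇒∣n (subst (e ∣_) (trans (cong (_∸ 1)
      (trans (sym (trans eq (*-identityˡ c))) (trans (sym (+-identityʳ n)) exponent)))
      (+-∸-assoc e (<⇒≤ 1<κ))) e∣c∸1) ∣-refl
  impossible (inj₂ (1<κ , refl)) (suc (suc q)) eq = <-irrefl refl (begin-strict
    n               ≡⟨ trans (sym (+-identityʳ n)) exponent ⟩
    e + κ           ≤⟨ +-monoʳ-≤ e κ≤e ⟩
    e + e           <⟨ +-mono-< e<c e<c ⟩
    c + c           ≤⟨ +-monoʳ-≤ c (m≤m+n c (q * c)) ⟩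
    (2 + q) * c     ≡⟨ eq ⟨
    n               ∎)

coprime-*∣ : ∀ {m n o} → Coprime m n → m ∣ o → n ∣ o → m * n ∣ o
coprime-*∣ {m} {n} m⊥n m∣o (divides k eq) = subst (m * n ∣_) (sym eq)
  (*-monoˡ-∣ n (coprime-divisor m⊥n (subst (m ∣_) (trans eq (*-comm k n)) m∣o)))

solution-step : ∀ {a κ j n e} → 1 < a → κ ≡ 0 ⊎ (1 < κ × j ≡ 0) → 0 < n → Solution a κ j n e →
  ∃[ n′ ] ∃[ e′ ] (Solution a κ j n′ e′ × n < n′)
solution-step {a} {κ} {j} {n} {e} 1<a hκ 0<n sol with zsigmondy 1<a (Solution.threshold≤e sol)
... | suc m , prim , 2e+1<M = n * suc m , e + n * m , record
  { exponent    = trans (rearrange₁ n m j) (trans (cong (_+ n * m) exponent) (rearrange₂ e κ (n * m)))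
  ; divides-^∸1 = ∣-trans
      (coprime-*∣ (solution-coprime hκ 0<n sol prim) divides-^∸1 (PrimitivePart.∣-^∸1 prim))
      (^∸1-mono-∣ a {{>-nonZero (<-trans z<s 1<a)}}
        (∣m∣n⇒∣m+n ∣-refl (∣n⇒∣m*n n (PrimitivePart.divisors prim ∣-refl))))
  ; κ≤e         = ≤-trans κ≤e (m≤m+n e _)
  ; threshold≤e = ≤-trans threshold≤e (m≤m+n e _)
  } , m<m*n n (suc m) {{>-nonZero 0<n}} (≤-<-trans (m≤n+m 1 (2 * e)) 2e+1<M)
  where
  open Solution sol
  rearrange₁ : ∀ n m j → n * suc m + j ≡ n + j + n * m
  rearrange₁ = solve-∀
  rearrange₂ : ∀ e κ x → e + κ + x ≡ e + x + κ
  rearrange₂ = solve-∀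

solutions-unbounded : ∀ {a κ j n e} → 1 < a → κ ≡ 0 ⊎ (1 < κ × j ≡ 0) → 0 < n → Solution a κ j n e →
  ∀ N → ∃[ n′ ] ∃[ e′ ] (Solution a κ j n′ e′ × N < n′)
solutions-unbounded 1<a hκ 0<n sol zero    = _ , _ , sol , 0<n
solutions-unbounded 1<a hκ 0<n sol (suc N) with solutions-unbounded 1<a hκ 0<n sol N
... | n′ , e′ , sol′ , N<n′ with solution-step 1<a hκ (≤-<-trans z≤n N<n′) sol′
... | n″ , e″ , sol″ , n′<n″ = n″ , e″ , sol″ , ≤-<-trans N<n′ n′<n″

-- Starting solutions.

-- Found by computer search: for every small (a , k) some pair (n , d) here satisfies
-- n ∣ a ^ d − 1 and d ∣ n − k.
smallSeeds : List (ℕ × ℕ)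
smallSeeds =
    (24 , 2) ∷ (63 , 6) ∷ (91 , 12) ∷ (455 , 12) ∷ (481 , 36) ∷ (65 , 12) ∷ (40 , 4) ∷ (31 , 5)
  ∷ (73 , 9) ∷ (127 , 7) ∷ (341 , 30) ∷ (28 , 2) ∷ (511 , 9) ∷ (33 , 10) ∷ (40 , 2) ∷ (63 , 3)
  ∷ (65 , 4) ∷ (40369 , 117) ∷ (22 , 5) ∷ (27 , 3) ∷ (35 , 2) ∷ (37 , 3) ∷ (43 , 3) ∷ (75 , 4)
  ∷ (89 , 11) ∷ (211 , 3) ∷ (215 , 3) ∷ (20737 , 319) ∷ (8 , 2) ∷ (21 , 2) ∷ (25 , 4) ∷ (28 , 6)
  ∷ (33 , 2) ∷ (41 , 8) ∷ (62 , 3) ∷ (67 , 11) ∷ (113 , 4) ∷ (121 , 5) ∷ (157 , 3) ∷ (233 , 29)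
  ∷ (1727 , 3) ∷ (8191 , 13) ∷ (9299 , 112) ∷ (131071 , 17) ∷ (178481 , 23) ∷ (524287 , 19)
  ∷ (25 , 5) ∷ (29 , 7) ∷ (36 , 6) ∷ (41 , 5) ∷ (49 , 3) ∷ (49 , 7) ∷ (55 , 4) ∷ (91 , 3)
  ∷ (115 , 11) ∷ (119 , 3) ∷ (121 , 11) ∷ (123 , 5) ∷ (143 , 5) ∷ (199 , 11) ∷ (311 , 5)
  ∷ (421 , 3) ∷ (551 , 7) ∷ (601 , 25) ∷ (791 , 4) ∷ (871 , 11) ∷ (1517 , 15) ∷ (3761 , 5)
  ∷ (14617 , 115) ∷ (18631 , 25) ∷ (22621 , 5) ∷ (1063187 , 115) ∷ []

-- A divisor d of e keeps the power to be evaluated small. The condition κ ≤ n + j guards the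
-- truncated subtraction in e.
IsSeed : ℕ → ℕ → ℕ → ℕ × ℕ → Set
IsSeed a κ j (n , d) = let e = n + j ∸ κ in
  d ∣ e × threshold a ≤ e × κ ≤ e × κ ≤ n + j × 0 < n × n ∣ a ^ d ∸ 1

isSeed? : ∀ a κ j nd → Dec (IsSeed a κ j nd)
isSeed? a κ j (n , d) = let e = n + j ∸ κ in
  d ∣? e ×-dec threshold a ≤? e ×-dec κ ≤? e ×-dec κ ≤? n + j ×-dec 0 <? n ×-dec n ∣? a ^ d ∸ 1

HasSolution : ℕ → ℕ → ℕ → Set
HasSolution a κ j = ∃[ n ] ∃[ e ] (Solution a κ j n e × 0 < n)

seed⇒solution : ∀ {a κ j} .{{_ : NonZero a}} → Any (IsSeed a κ j) smallSeeds → HasSolution a κ j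
seed⇒solution {a} {κ} {j} seed with Any.satisfied seed
... | (n , d) , d∣e , t≤e , κ≤e , κ≤n+j , 0<n , n∣ = n , n + j ∸ κ , record
  { exponent    = sym (m∸n+n≡m κ≤n+j)
  ; divides-^∸1 = ∣-trans n∣ (^∸1-mono-∣ a d∣e)
  ; κ≤e         = κ≤e
  ; threshold≤e = t≤e
  } , 0<n

SmallPositive : ℕ → ℕ → Set
SmallPositive a κ = 2 ≤ a → κ ≢ 1 → ¬ (κ ≡ 0 × a ≡ 2) → κ ≤ threshold a → a ≤ threshold a + κ →
  Any (IsSeed a κ 0) smallSeeds

-- The ranges come from κ ≤ `threshold a` ≤ 31 and a ≤ `threshold a` + κ ≤ 62.
smallPositive : ∀ {a} → a < 63 → ∀ {κ} → κ < 32 → SmallPositive a κ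
smallPositive = from-yes (allUpTo? (λ a → allUpTo? (λ κ →
    2 ≤? a →-dec ¬? (κ ≟ 1) →-dec ¬? (κ ≟ 0 ×-dec a ≟ 2) →-dec κ ≤? threshold a →-dec
    a ≤? threshold a + κ →-dec any? (isSeed? a κ 0) smallSeeds)
  32) 63)

SmallNegative : ℕ → ℕ → Set
SmallNegative a i = 2 ≤ a → 2 + i ≤ threshold a → a + i < threshold a → Any (IsSeed a 0 (suc i)) smallSeeds

smallNegative : ∀ {a} → a < 31 → ∀ {i} → i < 31 → SmallNegative a i
smallNegative = from-yes (allUpTo? (λ a → allUpTo? (λ i →
    2 ≤? a →-dec 2 + i ≤? threshold a →-dec a + i <? threshold a →-dec any? (isSeed? a 0 (suc i)) smallSeeds)
  31) 31)

solution-positive : ∀ a κ → 1 < a → κ ≢ 1 → ¬ (κ ≡ 0 × a ≡ 2) → HasSolution a κ 0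
solution-positive a κ 1<a κ≢1 ¬02 with threshold a <? κ
... | yes t<κ = from-1 κ t<κ
  where
  from-1 : ∀ κ → threshold a < κ → HasSolution a κ 0
  from-1 (suc d) (s≤s t≤d) with zsigmondy 1<a t≤d
  ... | M , prim , 2d+1<M with m≤n⇒∃[o]m+o≡n 2d+1<M
  -- M = 2 κ + o with κ = d + 1, so e = M - κ = κ + o is at least κ; here 2 d + 1 < M is used in
  -- full. Since d divides M - 1 = d + e, it divides e.
  ... | o , refl = 1 + d + e , e , record
    { exponent    = rearrange₁ d e
    ; divides-^∸1 = subst (_∣ a ^ e ∸ 1) (rearrange₂ d o) (∣-trans (PrimitivePart.∣-^∸1 prim)
        (^∸1-mono-∣ a {{>-nonZero (<-trans z<s 1<a)}}
          (∣m+n∣m⇒∣n (subst (d ∣_) (rearrange₃ d o) (PrimitivePart.divisors prim ∣-refl)) ∣-refl)))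
    ; κ≤e         = m≤m+n (suc d) o
    ; threshold≤e = ≤-trans t≤d (≤-trans (n≤1+n d) (m≤m+n (suc d) o))
    } , z<s
    where
    e = suc d + o
    rearrange₁ : ∀ d e → 1 + d + e + 0 ≡ e + suc d
    rearrange₁ = solve-∀
    rearrange₂ : ∀ d o → suc (2 * d + 1) + o ≡ 1 + d + (suc d + o)
    rearrange₂ = solve-∀
    rearrange₃ : ∀ d o → 2 * d + 1 + o ≡ d + (suc d + o)
    rearrange₃ = solve-∀
... | no t≮κ with threshold a + κ <? a
... | no ≮ = seed⇒solution {{>-nonZero (<-trans z<s 1<a)}}
  (smallPositive (s≤s (≤-trans a≤ (+-mono-≤ (threshold≤31 a) κ≤31))) (s≤s κ≤31) 1<a κ≢1 ¬02 κ≤t a≤)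
  where
  a≤ : a ≤ threshold a + κ
  a≤ = ≮⇒≥ ≮
  κ≤t : κ ≤ threshold a
  κ≤t = ≮⇒≥ t≮κ
  κ≤31 : κ ≤ 31
  κ≤31 = ≤-trans κ≤t (threshold≤31 a)
... | yes t+κ<a = a ∸ 1 , a ∸ 1 ∸ κ , record
  { exponent    = trans (+-identityʳ _) (sym (m∸n+n≡m (≤-trans (m≤n+m κ (threshold a)) t+κ≤a∸1)))
  ; divides-^∸1 = subst (λ z → z ∸ 1 ∣ a ^ (a ∸ 1 ∸ κ) ∸ 1) (*-identityʳ a)
      (^∸1-mono-∣ a {{>-nonZero (<-trans z<s 1<a)}} (1∣ (a ∸ 1 ∸ κ)))
  ; κ≤e         = ≤-trans (≮⇒≥ t≮κ) t≤e
  ; threshold≤e = t≤e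
  } , m<n⇒0<n∸m 1<a
  where
  t+κ≤a∸1 : threshold a + κ ≤ a ∸ 1
  t+κ≤a∸1 = ∸-monoˡ-≤ 1 t+κ<a
  t≤e : threshold a ≤ a ∸ 1 ∸ κ
  t≤e = ≤-trans (≤-reflexive (sym (m+n∸n≡m (threshold a) κ))) (∸-monoˡ-≤ κ t+κ≤a∸1)

-- Here k = -(1 + i), so n = 1 and n = a - 1 have exponents 2 + i and a + i. The table is for the
-- cases in which both are too small.
solution-negative : ∀ a i → 1 < a → HasSolution a 0 (suc i)
solution-negative a i 1<a with threshold a <? 2 + i
... | yes t<2+i = 1 , 2 + i , record
  { exponent    = sym (+-identityʳ _)
  ; divides-^∸1 = 1∣ _
  ; κ≤e         = z≤n
  ; threshold≤e = <⇒≤ t<2+i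
  } , z<s
... | no t≮2+i with a + i <? threshold a
... | yes a+i<t = seed⇒solution {{>-nonZero (<-trans z<s 1<a)}}
  (smallNegative (≤-trans (s≤s (m≤m+n a i)) a+i<31) (≤-trans (s≤s (m≤n+m i a)) a+i<31) 1<a (≮⇒≥ t≮2+i) a+i<t)
  where
  a+i<31 : a + i < 31
  a+i<31 = ≤-trans a+i<t (threshold≤31 a)
... | no a+i≮t = a ∸ 1 , a + i , record
  { exponent    = trans (trans (+-suc (a ∸ 1) i) (cong (_+ i) (suc-pred a {{>-nonZero (<-trans z<s 1<a)}})))
                        (sym (+-identityʳ (a + i)))
  ; divides-^∸1 = subst (λ z → z ∸ 1 ∣ a ^ (a + i) ∸ 1) (*-identityʳ a)
      (^∸1-mono-∣ a {{>-nonZero (<-trans z<s 1<a)}} (1∣ (a + i)))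
  ; κ≤e         = z≤n
  ; threshold≤e = ≮⇒≥ a+i≮t
  } , m<n⇒0<n∸m 1<a

-- Integer exponents, the cases k = 1 and (k , a) = (0 , 2), and the conclusion.

∣^∸1∣ : ∀ {a} e → 1 < a → abs (+ (a ^ e) - + 1) ≡ a ^ e ∸ 1
∣^∸1∣ {a} e 1<a = cong abs (⊖-≥ (m^n>0 a {{>-nonZero (<-trans z<s 1<a)}} e))

∣^∸1⇒expCong : ∀ {a n e i} → 1 < a → i ≡ + e → n ∣ a ^ e ∸ 1 → ExpCong a n i
∣^∸1⇒expCong {n = n} {e} 1<a refl n∣ = subst (n ∣_) (sym (∣^∸1∣ e 1<a)) n∣

-- For k = 1, M serves with exponent M - 1, a multiple of d. Larger solutions come from larger d, as
-- `solution-coprime` does not cover κ = 1.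
∃-∣^[n-1]∸1 : ∀ {a d} → 1 < a → threshold a ≤ d → ∃[ e ] (d < e × suc e ∣ a ^ e ∸ 1)
∃-∣^[n-1]∸1 {a} {d} 1<a t≤d with zsigmondy 1<a t≤d
... | suc e , prim , s≤s 2d+1≤e = e , ≤-trans d<2d+1 2d+1≤e ,
  ∣-trans (PrimitivePart.∣-^∸1 prim)
    (^∸1-mono-∣ a {{>-nonZero (<-trans z<s 1<a)}} (PrimitivePart.divisors prim ∣-refl))
  where
  d<2d+1 : d < 2 * d + 1
  d<2d+1 = ≤-trans (≤-reflexive (+-comm 1 d)) (+-monoˡ-≤ 1 (m≤m+n d (d + 0)))

∃-smallerPrimeDivisor : ∀ {p} a .{{_ : NonZero a}} n .{{_ : NonZero n}} →
  Prime p → p ∣ a ^ n ∸ 1 → ¬ p ∣ a ∸ 1 → ∃[ q ] (q < p × Prime q × q ∣ n)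
∃-smallerPrimeDivisor {p} a n pp p∣a^n∸1 p∤a∸1 =
  go (gcd n (p ∸ 1)) (gcd[m,n]∣m n (p ∸ 1)) (gcd[m,n]∣n n (p ∸ 1)) (prime∣^∸1-gcd a n pp p∣a^n∸1)
  where
  instance
    p∸1≢0 : NonZero (p ∸ 1)
    p∸1≢0 = >-nonZero (m<n⇒0<n∸m (prime>1 pp))
  go : ∀ g → g ∣ n → g ∣ p ∸ 1 → p ∣ a ^ g ∸ 1 → ∃[ q ] (q < p × Prime q × q ∣ n)
  go 0 0∣n _ _ = contradiction (0∣⇒≡0 0∣n) (≢-nonZero⁻¹ n)
  go 1 _ _ p∣  = contradiction (subst (λ z → p ∣ z ∸ 1) (*-identityʳ a) p∣) p∤a∸1
  go g@(suc (suc _)) g∣n g∣p∸1 _ with ∃-primeDivisor g (s<s z<s)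
  ... | q , pq , q∣g = q , ≤-trans (s≤s (∣⇒≤ (∣-trans q∣g g∣p∸1)))
    (≤-reflexive (suc-pred p {{prime⇒nonZero pp}})) , pq , ∣-trans q∣g g∣n

∤2^n∸1 : ∀ n → 1 < n → ¬ n ∣ 2 ^ n ∸ 1
∤2^n∸1 n 1<n n∣ with ∃-primeDivisor n 1<n
... | p , pp , p∣n = <-rec (λ p → Prime p → p ∣ n → ⊥) descent p pp p∣n
  where
  descent : ∀ p → (∀ {q} → q < p → Prime q → q ∣ n → ⊥) → Prime p → p ∣ n → ⊥
  descent p rec pp p∣n with ∃-smallerPrimeDivisor 2 n {{>-nonZero (<-trans z<s 1<n)}} pp (∣-trans p∣n n∣)
                              (λ p∣1 → >⇒≢ (prime>1 pp) (∣1⇒≡1 p∣1))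
  ... | q , q<p , pq , q∣n = rec q<p pq q∣n

[e+κ]-κ≡e : ∀ n e κ → n + 0 ≡ e + κ → + n - + κ ≡ + e
[e+κ]-κ≡e n e κ eq = trans (m-n≡m⊖n n κ) (trans (⊖-≥ κ≤n) (cong +_ (trans (cong (_∸ κ) n≡) (m+n∸n≡m e κ))))
  where
  n≡ : n ≡ e + κ
  n≡ = trans (sym (+-identityʳ n)) eq
  κ≤n : κ ≤ n
  κ≤n = ≤-trans (m≤n+m κ e) (≤-reflexive (sym n≡))

unbounded : (a : ℕ) (k : ℤ) → 1 < a → ¬ (k ≡ + 0 × a ≡ 2) → ∀ N → ∃[ n ] (N < n × ExpCong a n (+ n - k))
unbounded a (+ 1) 1<a _ N 
  with ∃-∣^[n-1]∸1 {d = threshold a + N} 1<a (m≤m+n (threshold a) N)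
... | e , d<e , e∣ = suc e , m≤n⇒m≤1+n (≤-trans (s≤s (m≤n+m N (threshold a))) d<e) ,
  ∣^∸1⇒expCong {e = e} 1<a refl e∣
unbounded a (+ 0) 1<a ¬02 N
  with solution-positive a 0 1<a (λ ()) (λ (_ , a≡2) → ¬02 (refl , a≡2))
... | _ , _ , sol , 0<n with solutions-unbounded 1<a (inj₁ refl) 0<n sol N
... | n , e , sol′ , N<n = n , N<n ,
  -- `+ n - + 0` computes to `+ (n + 0)`, the left side of `exponent` for j = 0; in the negative
  -- case `+ n - -[1+ i ]` likewise computes to `+ (n + suc i)`.
  ∣^∸1⇒expCong 1<a (cong +_ (trans (Solution.exponent sol′) (+-identityʳ e))) (Solution.divides-^∸1 sol′)
unbounded a (+ κ@(suc (suc _))) 1<a _ N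
  with solution-positive a κ 1<a (λ ()) (λ ())
... | _ , _ , sol , 0<n with solutions-unbounded 1<a (inj₂ (s<s z<s , refl)) 0<n sol N
... | n , e , sol′ , N<n = n , N<n ,
  ∣^∸1⇒expCong 1<a ([e+κ]-κ≡e n e κ (Solution.exponent sol′)) (Solution.divides-^∸1 sol′)
unbounded a -[1+ i ] 1<a _ N with solution-negative a i 1<a
... | _ , _ , sol , 0<n with solutions-unbounded 1<a (inj₁ refl) 0<n sol N
... | n , e , sol′ , N<n = n , N<n ,
  ∣^∸1⇒expCong 1<a (cong +_ (trans (Solution.exponent sol′) (+-identityʳ e))) (Solution.divides-^∸1 sol′)

theorem7p3 : (a : ℕ) → (k : ℤ) → 2 ≤ a →
    (¬ (k ≡ + 0 × a ≡ 2) → ∀ (N : ℕ) → ∃[ n ] (N < n × ExpCong a n ((+ n) - k)))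
    × (k ≡ + 0 → a ≡ 2 → ∀ (n : ℕ) → 1 < n → ¬ ExpCong a n ((+ n) - k))
theorem7p3 a k 2≤a = unbounded a k 2≤a , λ { refl refl n 1<n cong-n → ∤2^n∸1 n 1<n
  (subst (n ∣_) (trans (∣^∸1∣ (n + 0) 2≤a) (cong (λ e → 2 ^ e ∸ 1) (+-identityʳ n))) cong-n) }
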